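{- Define $f_1(m_1,m_2)=33m_1+49m_2$ and, for every $t\geq 2$, $$f_t(m_1,m_2)=f_{t-1}\big(f_{t-1}(32m_1+49m_2,\,m_1+m_2-1),\,32m_1+49m_2\big).$$ Let $m_1,m_2$ and $n_1,\ldots,n_t$ be positive integers such that $m_2\geq n_i\geq 2\lceil \log (f_t(m_1,m_2))\rceil+2$ for each $1\leq i\leq t$. Then $$R(C_{n_1},\ldots,C_{n_t},K_{m_1,m_2})\leq f_t(m_1,m_2).$$
   Context: $C_k$ denotes the cycle on $k$ vertices and $K_{a,b}$ the complete bipartite graph with parts of sizes $a$ and $b$. For graphs $G_1,\ldots,G_k$, the Ramsey number $R(G_1,\ldots,G_k)$ is the smallest integer $N$ such that for every coloring of the edges of the complete graph $K_N$ with colors $1,\ldots,k$ there is, for some $i$, a copy of $G_i$ all of whose edges have color $i$. $\log$ denotes the logarithm to base $2$. -}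

module Defs where

open import Data.Nat using (ℕ; zero; suc; _+_; _*_; _∸_; _≤_; _<_; NonZero)
open import Data.Nat.Properties using (<⇒≱)
open import Data.Fin using (Fin; toℕ)
open import Data.Product using (_×_; _,_; ∃)
open import Data.Sum as Sum using (_⊎_; inj₁; inj₂)
open import Data.Vec using (Vec; lookup)
open import Function.Base using (_∘_)
open import Function.Definitions using (Injective)
open import Relation.Binary.PropositionalEquality using (_≡_; _≢_; refl; sym)
open import Relation.Nullary using (¬_)

record Graph : Set₁ where
  field
    order      : ℕ
    Adj        : Fin order → Fin order → Set
    adj-sym    : ∀ {u v} → Adj u v → Adj v u
    adj-irrefl : ∀ {u} → ¬ Adj u u

  Vertex : Set
  Vertex = Fin order

-- v is the successor of u in the cyclic order 0, 1, …, k - 1, 0.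
CyclicSuc : ∀ {k} → Fin k → Fin k → Set
CyclicSuc {k} u v = suc (toℕ u) ≡ toℕ v ⊎ (suc (toℕ u) ≡ k × toℕ v ≡ 0)

-- The cycle on k vertices for k ≥ 3.  The condition u ≢ v only matters for
-- k = 1, where it excludes a loop.
C : ℕ → Graph
C k = record
  { order      = k
  ; Adj        = λ u v → u ≢ v × (CyclicSuc u v ⊎ CyclicSuc v u)
  ; adj-sym    = λ (u≢v , e) → u≢v ∘ sym , Sum.swap e
  ; adj-irrefl = λ (u≢u , _) → u≢u refl
  }

-- The parts are the first a vertices and the last b vertices.
K : ℕ → ℕ → Graph
K a b = record
  { order      = a + b
  ; Adj        = λ u v → (toℕ u < a × a ≤ toℕ v) ⊎ (toℕ v < a × a ≤ toℕ u)
  ; adj-sym    = Sum.swap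
  ; adj-irrefl = λ { (inj₁ (u<a , a≤u)) → <⇒≱ u<a a≤u
                   ; (inj₂ (u<a , a≤u)) → <⇒≱ u<a a≤u }
  }

-- A colouring of the edges of the complete graph on Fin N with k ≥ 1 colours.
-- The values colour u u carry no meaning: copies of graphs are injective and
-- graphs are loopless, so these values are never inspected.
record EdgeColouring (N k : ℕ) : Set where
  field
    colour     : Fin N → Fin N → Fin k
    colour-sym : ∀ u v → colour u v ≡ colour v u

record MonochromaticCopy {N k} (G : Graph) (c : EdgeColouring N k) (i : Fin k) : Set where
  open Graph G
  open EdgeColouring c
  field
    embed      : Vertex → Fin N
    injective  : Injective _≡_ _≡_ embed
    monochrome : ∀ {u v} → Adj u v → colour (embed u) (embed v) ≡ i

Arrows : ∀ {k} → ℕ → Vec Graph k → Set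
Arrows {k} N Gs = (c : EdgeColouring N k) → ∃ λ i → MonochromaticCopy (lookup Gs i) c i

IsRamseyNumber : ∀ {k} → Vec Graph k → ℕ → Set
IsRamseyNumber Gs R = Arrows R Gs × (∀ N → Arrows N Gs → R ≤ N)

f : (t : ℕ) .{{_ : NonZero t}} → ℕ → ℕ → ℕ
f (suc zero)    m₁ m₂ = 33 * m₁ + 49 * m₂
f (suc (suc t)) m₁ m₂ =
  f (suc t) (f (suc t) (32 * m₁ + 49 * m₂) (m₁ + m₂ ∸ 1)) (32 * m₁ + 49 * m₂)

{-# OPTIONS --safe #-}

-- Two colours, three parts: suppose all pairs between disjoint sets A, B, Z are red or blue,
-- ∣A∣, ∣B∣ ≥ 16m₁+24m₂, ∣Z∣ ≥ m₁+m₂−1, and there is no blue K_{m₁,m₂}.  Put m = min(m₁,m₂)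
-- and M = max(m₁,m₂), and consider the bipartite red graph between A and B.  Reserve four
-- disjoint pieces of A ∪ B.  Deleting a maximal non-expanding set from two of them leaves
-- graphs in which every set X with ∣X∣ ≤ m has at least 3∣X∣ neighbours.  Depth-first search
-- in the third piece gives a red path with any prescribed even number of vertices, whose ends
-- lie on opposite sides and have neighbours in the two expanders.  From these neighbours, levels
-- of size 1, 2, 4, … reach size at least m after d ≈ log m steps, and one further step into the
-- fourth piece gives end sets of size at least M.  Hence there are sets X ⊆ A, Y ⊆ B (or vice
-- versa) of size at least M such that any x ∈ X and y ∈ Y are the ends of a red path of
-- prescribed even order.  A red edge between X and Y closes an even cycle; a vertex of Z with red
-- neighbours in both X and Y closes an odd one.
--
-- For t = 1 the complete graph on 33m₁+49m₂ vertices is cut into such parts.  For t ≥ 2 one cycle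
-- colour is merged with the last colour; two applications of the induction hypothesis, the second
-- inside a part of the K found by the first, give three parts coloured with the merged colours.
module Submission where

open import Data.Bool using (Bool; true; false; not)
open import Data.Bool.Properties using (not-involutive; not-¬) renaming (_≟_ to _≟ᵇ_)
open import Data.Empty using (⊥)
open import Data.Fin using (Fin; zero; suc; toℕ; fromℕ; splitAt; _↑ˡ_; _↑ʳ_)
open import Data.Fin.Properties using (any?; all?; suc-injective; toℕ<n; toℕ-↑ˡ; toℕ-↑ʳ; ↑ˡ-injective; ↑ʳ-injective; splitAt-<; splitAt-≥; splitAt⁻¹-↑ˡ; splitAt⁻¹-↑ʳ) renaming (_≟_ to _≟ᶠ_)
open import Data.Fin.Subset using (Subset; inside; outside; _∈_; _∉_; _⊆_; _∪_; _∩_; _─_; _-_; ∣_∣; ⁅_⁆; Nonempty; ⊤) renaming (⊥ to ∅)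
open import Data.Fin.Subset.Properties
open import Data.Nat hiding (∣_-_∣)
open import Data.Nat.Logarithm using (⌈log₂_⌉; ⌈log₂⌉-mono-≤; ⌈log₂2^n⌉≡n)
open import Data.Nat.Properties hiding (suc-injective)
open import Data.Nat.Solver using (module +-*-Solver)
open import Data.Product using (_×_; _,_; ∃; ∃₂; proj₁; proj₂)
open import Data.Sum using (_⊎_; inj₁; inj₂; [_,_]; [_,_]′)
open import Data.Vec using (Vec; []; _∷_; lookup; map; _∷ʳ_; tabulate; here; there)
open import Data.Vec.Properties using (lookup∘tabulate; lookup⇒[]=; []=⇒lookup)
open import Function.Base using (_∘_; case_of_)
open import Function.Definitions using (Injective)
open import Relation.Binary.PropositionalEquality using (_≡_; _≢_; refl; sym; trans; cong; cong₂; subst)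
open import Relation.Nullary using (¬_; Dec; yes; no; does; contradiction)
open import Relation.Nullary.Decidable using (_×-dec_; _⊎-dec_; _→-dec_; ¬?; map′; dec-true; dec-false; decidable-stable)
open import Relation.Unary using (Decidable)
open import Defs

open ≤-Reasoning
open +-*-Solver using (solve; con; _:=_; _:+_; _:*_)

-- Finite subsets

private variable
  n k : ℕ
  p : Subset n
  x : Fin n

⟦_⟧ : {P : Fin n → Set} → Decidable P → Subset n
⟦ P? ⟧ = tabulate (does ∘ P?)

∈⟦⟧⁺ : {P : Fin n → Set} (P? : Decidable P) → P x → x ∈ ⟦ P? ⟧
∈⟦⟧⁺ {x = x} P? px = lookup⇒[]= x _ (trans (lookup∘tabulate (does ∘ P?) x) (dec-true (P? x) px))

∈⟦⟧⁻ : {P : Fin n → Set} (P? : Decidable P) → x ∈ ⟦ P? ⟧ → P x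
∈⟦⟧⁻ {x = x} P? x∈ with P? x | trans (sym (lookup∘tabulate (does ∘ P?) x)) ([]=⇒lookup x∈)
... | yes px | _ = px
... | no _ | ()

x∈p─q⇒x∉q : ∀ (p q : Subset n) → x ∈ p ─ q → x ∉ q
x∈p─q⇒x∉q (_ ∷ p) (outside ∷ q) (there x∈) (there x∈q) = x∈p─q⇒x∉q p q x∈ x∈q
x∈p─q⇒x∉q (_ ∷ p) (inside  ∷ q) (there x∈) (there x∈q) = x∈p─q⇒x∉q p q x∈ x∈q

∣p∪q∣≤∣p∣+∣q∣ : ∀ (p q : Subset n) → ∣ p ∪ q ∣ ≤ ∣ p ∣ + ∣ q ∣
∣p∪q∣≤∣p∣+∣q∣ [] [] = z≤n
∣p∪q∣≤∣p∣+∣q∣ (outside ∷ p) (outside ∷ q) = ∣p∪q∣≤∣p∣+∣q∣ p q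
∣p∪q∣≤∣p∣+∣q∣ (outside ∷ p) (inside ∷ q) rewrite +-suc ∣ p ∣ ∣ q ∣ = s≤s (∣p∪q∣≤∣p∣+∣q∣ p q)
∣p∪q∣≤∣p∣+∣q∣ (inside ∷ p) (outside ∷ q) = s≤s (∣p∪q∣≤∣p∣+∣q∣ p q)
∣p∪q∣≤∣p∣+∣q∣ (inside ∷ p) (inside ∷ q) rewrite +-suc ∣ p ∣ ∣ q ∣ = s≤s (m≤n⇒m≤1+n (∣p∪q∣≤∣p∣+∣q∣ p q))

Disjoint : Subset n → Subset n → Set
Disjoint p q = ∀ {x} → x ∈ p → x ∉ q

disjoint⇒∣p∣+∣q∣≤∣p∪q∣ : ∀ (p q : Subset n) → Disjoint p q → ∣ p ∣ + ∣ q ∣ ≤ ∣ p ∪ q ∣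
disjoint⇒∣p∣+∣q∣≤∣p∪q∣ [] [] dis = z≤n
disjoint⇒∣p∣+∣q∣≤∣p∪q∣ (s ∷ p) (t ∷ q) dis
  with s | t | dis {zero} | disjoint⇒∣p∣+∣q∣≤∣p∪q∣ p q (λ x∈p x∈q → dis (there x∈p) (there x∈q))
... | outside | outside | _  | ih = ih
... | outside | inside  | _  | ih rewrite +-suc ∣ p ∣ ∣ q ∣ = s≤s ih
... | inside  | outside | _  | ih = s≤s ih
... | inside  | inside  | d₀ | ih = contradiction here (d₀ here)

⊆∪⇒∣∣≤ : ∀ (q r : Subset n) → p ⊆ q ∪ r → ∣ p ∣ ≤ ∣ q ∣ + ∣ r ∣
⊆∪⇒∣∣≤ q r p⊆ = ≤-trans (p⊆q⇒∣p∣≤∣q∣ p⊆) (∣p∪q∣≤∣p∣+∣q∣ q r)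

∣p∣≤∣p─q∣+∣q∣ : ∀ (p q : Subset n) → ∣ p ∣ ≤ ∣ p ─ q ∣ + ∣ q ∣
∣p∣≤∣p─q∣+∣q∣ p q = ⊆∪⇒∣∣≤ (p ─ q) q λ {x} x∈p → case x ∈? q of λ
  { (yes x∈q) → x∈p∪q⁺ (inj₂ x∈q)
  ; (no x∉q) → x∈p∪q⁺ (inj₁ (x∈p∧x∉q⇒x∈p─q x∈p x∉q)) }

∣p∪⁅x⁆∣≤1+∣p∣ : ∀ (p : Subset n) x → ∣ p ∪ ⁅ x ⁆ ∣ ≤ suc ∣ p ∣
∣p∪⁅x⁆∣≤1+∣p∣ p x = begin
  ∣ p ∪ ⁅ x ⁆ ∣     ≤⟨ ∣p∪q∣≤∣p∣+∣q∣ p ⁅ x ⁆ ⟩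
  ∣ p ∣ + ∣ ⁅ x ⁆ ∣ ≡⟨ cong (∣ p ∣ +_) (∣⁅x⁆∣≡1 x) ⟩
  ∣ p ∣ + 1         ≡⟨ +-comm ∣ p ∣ 1 ⟩
  suc ∣ p ∣         ∎

∣p∣≤1+∣p-x∣ : ∀ (p : Subset n) x → ∣ p ∣ ≤ suc ∣ p - x ∣
∣p∣≤1+∣p-x∣ p x = begin
  ∣ p ∣                 ≤⟨ ∣p∣≤∣p─q∣+∣q∣ p ⁅ x ⁆ ⟩
  ∣ p - x ∣ + ∣ ⁅ x ⁆ ∣ ≡⟨ cong (∣ p - x ∣ +_) (∣⁅x⁆∣≡1 x) ⟩
  ∣ p - x ∣ + 1         ≡⟨ +-comm ∣ p - x ∣ 1 ⟩
  suc ∣ p - x ∣         ∎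

0<∣p∣⇒Nonempty : ∀ (p : Subset n) → 0 < ∣ p ∣ → Nonempty p
0<∣p∣⇒Nonempty (inside  ∷ p) _   = zero , here
0<∣p∣⇒Nonempty (outside ∷ p) 0<p with x , x∈p ← 0<∣p∣⇒Nonempty p 0<p = suc x , there x∈p

x∈p⇒0<∣p∣ : x ∈ p → 0 < ∣ p ∣
x∈p⇒0<∣p∣ x∈p = ≤-<-trans z≤n (x∈p⇒∣p-x∣<∣p∣ x∈p)

shrink : ∀ (p : Subset n) → k ≤ ∣ p ∣ → ∃ λ q → q ⊆ p × ∣ q ∣ ≡ k
shrink {n = n} {k = zero}  p  _   = ∅ , ⊥⊆ , ∣⊥∣≡0 n
shrink {k = suc k} (outside ∷ p) k≤p with q , q⊆p , eq ← shrink p k≤p = outside ∷ q , out⊆ q⊆p , eq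
shrink {k = suc k} (inside ∷ p) (s≤s k≤p) with q , q⊆p , eq ← shrink p k≤p = inside ∷ q , in⊆in q⊆p , cong suc eq

_∈image?_ : ∀ (x : Fin n) (e : Fin k → Fin n) → Dec (∃ λ i → e i ≡ x)
x ∈image? e = any? λ i → e i ≟ᶠ x

image : (Fin k → Fin n) → Subset n
image e = ⟦ _∈image? e ⟧

∈image⁺ : ∀ (e : Fin k → Fin n) i → e i ∈ image e
∈image⁺ e i = ∈⟦⟧⁺ (_∈image? e) (i , refl)

∈image⁻ : ∀ (e : Fin k → Fin n) → x ∈ image e → ∃ λ i → e i ≡ x
∈image⁻ e = ∈⟦⟧⁻ (_∈image? e)

injective⇒≤∣image∣ : ∀ (e : Fin k → Fin n) → Injective _≡_ _≡_ e → k ≤ ∣ image e ∣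
injective⇒≤∣image∣ {k = zero}  e inj = z≤n
injective⇒≤∣image∣ {k = suc k} e inj = begin-strict
  k                        ≤⟨ injective⇒≤∣image∣ (e ∘ suc) (suc-injective ∘ inj) ⟩
  ∣ image (e ∘ suc) ∣      ≤⟨ p⊆q⇒∣p∣≤∣q∣ tail⊆ ⟩
  ∣ image e - e zero ∣     <⟨ x∈p⇒∣p-x∣<∣p∣ (∈image⁺ e zero) ⟩
  ∣ image e ∣              ∎
  where
  tail⊆ : image (e ∘ suc) ⊆ image e - e zero
  tail⊆ x∈ with i , refl ← ∈image⁻ (e ∘ suc) x∈ =
    x∈p∧x≢y⇒x∈p-y (∈image⁺ e (suc i)) (λ eq → case inj eq of λ ())

enumerate : ∀ (p : Subset n) → k ≤ ∣ p ∣ →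
  ∃ λ (e : Fin k → Fin n) → Injective _≡_ _≡_ e × (∀ i → e i ∈ p)
enumerate {k = zero}  p _   = (λ ()) , (λ { {()} }) , λ ()
enumerate {n = n} {k = suc k} p k<p
  with x , x∈p ← 0<∣p∣⇒Nonempty p (≤-<-trans z≤n k<p)
  with e , inj , e∈ ← enumerate {k = k} (p - x) (s≤s⁻¹ (≤-trans k<p (∣p∣≤1+∣p-x∣ p x)))
  = e′ , e′-injective , e′∈
  where
  e′ : Fin (suc k) → Fin n
  e′ zero    = x
  e′ (suc i) = e i

  x≢e : ∀ i → x ≢ e i
  x≢e i eq = x∈p─q⇒x∉q p ⁅ x ⁆ (e∈ i) (subst (_∈ ⁅ x ⁆) eq (x∈⁅x⁆ x))

  e′-injective : Injective _≡_ _≡_ e′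
  e′-injective {zero}  {zero}  _  = refl
  e′-injective {zero}  {suc j} eq = contradiction eq (x≢e j)
  e′-injective {suc i} {zero}  eq = contradiction (sym eq) (x≢e i)
  e′-injective {suc i} {suc j} eq = cong suc (inj eq)

  e′∈ : ∀ i → e′ i ∈ p
  e′∈ zero    = x∈p
  e′∈ (suc i) = p─q⊆p p ⁅ x ⁆ (e∈ i)

-- Paths

flips : ℕ → Bool → Bool
flips zero    b = b
flips (suc k) b = not (flips k b)

flips-not : ∀ k b → flips k (not b) ≡ not (flips k b)
flips-not zero    b = refl
flips-not (suc k) b = cong not (flips-not k b)

flips-even : ∀ i b → flips (i + i) b ≡ b
flips-even zero    b = refl
flips-even (suc i) b rewrite +-suc i i = trans (not-involutive _) (flips-even i b)

module Paths {V : Set} (R : V → V → Set) where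

  -- The index counts vertices; shrinking S at each step makes them distinct.
  data Path (S : V → Set) : ℕ → V → V → Set where
    -- A path is never empty; its single-vertex case carries only membership in `S`.
    end  : ∀ {v} → S v → Path S 1 v v
    step : ∀ {k u w v} → S u → R u w → Path (λ x → S x × x ≢ u) k w v → Path S (suc k) u v

  weaken : ∀ {S T : V → Set} {k u v} → (∀ {x} → S x → T x) → Path S k u v → Path T k u v
  weaken S⇒T (end v∈)        = end (S⇒T v∈)
  weaken S⇒T (step u∈ r p) = step (S⇒T u∈) r (weaken (λ (x∈ , x≢) → S⇒T x∈ , x≢) p)

  append : ∀ {S T : V → Set} {j k u v w x} → (∀ {y} → S y → T y → ⊥) →
           Path S j u v → R v w → Path T k w x → Path (λ y → S y ⊎ T y) (j + k) u x
  append S#T (end v∈)         r q =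
    step (inj₁ v∈) r (weaken (λ y∈T → inj₂ y∈T , λ { refl → S#T v∈ y∈T }) q)
  append S#T (step u∈ r′ p) r q =
    step (inj₁ u∈) r′ (weaken (λ { (inj₁ (y∈S , y≢)) → inj₁ y∈S , y≢
                                 ; (inj₂ y∈T) → inj₂ y∈T , λ { refl → S#T u∈ y∈T } })
                                (append (S#T ∘ proj₁) p r q))

  reverse : ∀ {S k u v} → (∀ {x y} → R x y → R y x) → Path S k u v → Path S k v u
  reverse R-sym (end v∈) = end v∈
  -- The tail is reversed first and the one-vertex path `u` is appended to it. The tail avoids `u`,
  -- which is the disjointness that `append` asks for.
  reverse {S} {suc k} {u} {v} R-sym (step u∈ r p) =
    subst (λ l → Path S l v u) (+-comm k 1)
      (weaken [ proj₁ , (λ { refl → u∈ }) ]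
        (append (λ (_ , y≢) y≡ → y≢ y≡) (reverse R-sym p) (R-sym r) (end {S = _≡ u} refl)))

  source∈ : ∀ {S k u v} → Path S k u v → S u
  source∈ (end v∈)      = v∈
  source∈ (step u∈ _ _) = u∈

  at : ∀ {S k u v} → Path S k u v → Fin k → V
  at {v = v} (end _)      zero    = v
  at {u = u} (step _ _ p) zero    = u
  at         (step _ _ p) (suc i) = at p i

  at-∈ : ∀ {S k u v} (p : Path S k u v) i → S (at p i)
  at-∈ (end v∈)      zero    = v∈
  at-∈ (step u∈ _ p) zero    = u∈
  at-∈ (step _  _ p) (suc i) = proj₁ (at-∈ p i)

  at-injective : ∀ {S k u v} (p : Path S k u v) → Injective _≡_ _≡_ (at p)
  at-injective (end _)      {zero}  {zero}  _  = refl
  at-injective (step _ _ p) {zero}  {zero}  _  = refl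
  at-injective (step _ _ p) {zero}  {suc j} eq = contradiction (sym eq) (proj₂ (at-∈ p j))
  at-injective (step _ _ p) {suc i} {zero}  eq = contradiction eq (proj₂ (at-∈ p i))
  at-injective (step _ _ p) {suc i} {suc j} eq = cong suc (at-injective p eq)

  at-first : ∀ {S k u v} (p : Path S k u v) i → toℕ i ≡ 0 → at p i ≡ u
  at-first (end _)      zero _ = refl
  at-first (step _ _ p) zero _ = refl

  at-last : ∀ {S k u v} (p : Path S k u v) i → suc (toℕ i) ≡ k → at p i ≡ v
  at-last (end _)             zero    _  = refl
  at-last (step _ _ (end _))      (suc i) eq = at-last (end _) i (cong pred eq)
  at-last (step _ _ p@(step _ _ _)) (suc i) eq = at-last p i (cong pred eq)

  at-step : ∀ {S k u v} (p : Path S k u v) i j → suc (toℕ i) ≡ toℕ j → R (at p i) (at p j)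
  at-step (step _ r p) zero    (suc j) eq = subst (R _) (sym (at-first p j (sym (cong pred eq)))) r
  at-step (step _ _ p) (suc i) (suc j) eq = at-step p i j (cong pred eq)

-- Bipartite expanders

module Bipartite {N : ℕ} (R : Fin N → Fin N → Set) (R? : ∀ x y → Dec (R x y))
  (R-sym : ∀ {x y} → R x y → R y x)
  (σ : Fin N → Bool) (R-crosses : ∀ {x y} → R x y → σ x ≡ not (σ y)) where

  open Paths R public

  -- A path on `k + 1` vertices has `k` edges, and each edge changes sides.
  path-parity : ∀ {S k u v} → Path S (suc k) u v → σ u ≡ flips k (σ v)
  path-parity (end _)                    = refl
  -- Matching on the tail exhibits its index as a successor, which the recursive call needs.
  path-parity (step _ r p@(end _))       = trans (R-crosses r) (cong not (path-parity p))
  path-parity (step _ r p@(step _ _ _))  = trans (R-crosses r) (cong not (path-parity p))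

  adjacentTo? : ∀ S y → Dec (∃ λ x → x ∈ S × R x y)
  adjacentTo? S y = any? λ x → x ∈? S ×-dec R? x y

  Γ : Subset N → Subset N
  Γ S = ⟦ adjacentTo? S ⟧

  ∈Γ⁺ : ∀ {S x y} → x ∈ S → R x y → y ∈ Γ S
  ∈Γ⁺ x∈S r = ∈⟦⟧⁺ (adjacentTo? _) (_ , x∈S , r)

  ∈Γ⁻ : ∀ S {y} → y ∈ Γ S → ∃ λ x → x ∈ S × R x y
  ∈Γ⁻ S = ∈⟦⟧⁻ (adjacentTo? S)

  Expander : ℕ → Subset N → Set
  Expander m W = ∀ X → X ⊆ W → 1 ≤ ∣ X ∣ → ∣ X ∣ ≤ m → 3 * ∣ X ∣ ≤ ∣ Γ X ∩ W ∣

  ExpandsLarge : ℕ → ℕ → Subset N → Set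
  ExpandsLarge s k W = ∀ S → S ⊆ W → s ≤ ∣ S ∣ → k ≤ ∣ Γ S ∩ W ∣

  -- Only neighbours outside `S` are counted, which makes the property pass to unions of
  -- successively removed sets.
  Stagnant : Subset N → Subset N → Set
  Stagnant W S = ∣ Γ S ∩ (W ─ S) ∣ ≤ 3 * ∣ S ∣

  -- A neighbour of the union that lies outside it is a neighbour of `S` or of `X` and lies in
  -- `W ─ S` in both cases, so the two bounds add up.
  stagnant-∪ : ∀ {W S X} → Stagnant W S → X ⊆ W ─ S → ∣ Γ X ∩ (W ─ S) ∣ ≤ 3 * ∣ X ∣ → Stagnant W (S ∪ X)
  stagnant-∪ {W} {S} {X} stag X⊆ small = begin
    ∣ Γ (S ∪ X) ∩ (W ─ (S ∪ X)) ∣               ≤⟨ ⊆∪⇒∣∣≤ (Γ S ∩ (W ─ S)) (Γ X ∩ (W ─ S)) ⊆∪ ⟩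
    ∣ Γ S ∩ (W ─ S) ∣ + ∣ Γ X ∩ (W ─ S) ∣       ≤⟨ +-mono-≤ stag small ⟩
    3 * ∣ S ∣ + 3 * ∣ X ∣                       ≡⟨ *-distribˡ-+ 3 ∣ S ∣ ∣ X ∣ ⟨
    3 * (∣ S ∣ + ∣ X ∣)                         ≤⟨ *-monoʳ-≤ 3 (disjoint⇒∣p∣+∣q∣≤∣p∪q∣ S X λ x∈S x∈X →
                                                     x∈p─q⇒x∉q W S (X⊆ x∈X) x∈S) ⟩
    3 * ∣ S ∪ X ∣                               ∎
    where
    ⊆∪ : Γ (S ∪ X) ∩ (W ─ (S ∪ X)) ⊆ (Γ S ∩ (W ─ S)) ∪ (Γ X ∩ (W ─ S))
    ⊆∪ y∈ with y∈Γ , y∈W─ ← x∈p∩q⁻ (Γ (S ∪ X)) (W ─ (S ∪ X)) y∈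
          with x , x∈ , r ← ∈Γ⁻ (S ∪ X) y∈Γ
      = x∈p∪q⁺ (case x∈p∪q⁻ S X x∈ of λ
          { (inj₁ x∈S) → inj₁ (x∈p∩q⁺ (∈Γ⁺ x∈S r , y∈W─S))
          ; (inj₂ x∈X) → inj₂ (x∈p∩q⁺ (∈Γ⁺ x∈X r , y∈W─S)) })
      where
      y∈W─S = x∈p∧x∉q⇒x∈p─q (p─q⊆p W (S ∪ X) y∈W─)
                (λ y∈S → x∈p─q⇒x∉q W (S ∪ X) y∈W─ (p⊆p∪q X y∈S))

  stagnant⇒∣Γ∩W∣≤ : ∀ {W} S → Stagnant W S → ∣ Γ S ∩ W ∣ ≤ 4 * ∣ S ∣
  stagnant⇒∣Γ∩W∣≤ {W} S stag = begin
    ∣ Γ S ∩ W ∣               ≤⟨ ⊆∪⇒∣∣≤ (Γ S ∩ (W ─ S)) S ⊆∪ ⟩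
    ∣ Γ S ∩ (W ─ S) ∣ + ∣ S ∣ ≤⟨ +-monoˡ-≤ ∣ S ∣ stag ⟩
    3 * ∣ S ∣ + ∣ S ∣         ≡⟨ +-comm (3 * ∣ S ∣) ∣ S ∣ ⟩
    4 * ∣ S ∣                 ∎
    where
    ⊆∪ : Γ S ∩ W ⊆ (Γ S ∩ (W ─ S)) ∪ S
    ⊆∪ {x} x∈ with x∈Γ , x∈W ← x∈p∩q⁻ (Γ S) W x∈ = case x ∈? S of λ
      { (yes x∈S) → x∈p∪q⁺ (inj₂ x∈S)
      ; (no x∉S)  → x∈p∪q⁺ (inj₁ (x∈p∩q⁺ (x∈Γ , x∈p∧x∉q⇒x∈p─q x∈W x∉S))) }

  -- The removed set S is a union of sets that fail to expand; such a union fails to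
  -- expand as well, so it never reaches size 2m.
  expander-core : ∀ m W → 1 ≤ m → ExpandsLarge (2 * m) (12 * m) W →
    ∃ λ S → S ⊆ W × ∣ S ∣ < 2 * m × Expander m (W ─ S)
  expander-core m W 1≤m large = go (2 * m) ∅ ⊥⊆ ∅-stagnant ∅<2m (m≤m+n (2 * m) ∣ ∅ {N} ∣)
    where
    ∅<2m : ∣ ∅ {N} ∣ < 2 * m
    ∅<2m = begin-strict
      ∣ ∅ {N} ∣ ≡⟨ ∣⊥∣≡0 N ⟩
      0         <⟨ 1≤m ⟩
      m         ≤⟨ m≤m+n m _ ⟩
      2 * m     ∎

    ∅-stagnant : Stagnant W ∅
    ∅-stagnant = ≤-trans (p⊆q⇒∣p∣≤∣q∣ {q = ∅} λ x∈ →
      case ∈Γ⁻ ∅ (proj₁ (x∈p∩q⁻ (Γ ∅) (W ─ ∅) x∈)) of λ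
        { (_ , x∈∅ , _) → contradiction x∈∅ ∉⊥ }) (m≤m+n _ _)

    -- Each round adds at least one vertex to `S`, so `2 * m` rounds suffice; when `fuel` is
    -- exhausted the last hypothesis contradicts `∣ S ∣ < 2 * m`.
    go : ∀ fuel S → S ⊆ W → Stagnant W S → ∣ S ∣ < 2 * m → 2 * m ≤ fuel + ∣ S ∣ →
      ∃ λ S → S ⊆ W × ∣ S ∣ < 2 * m × Expander m (W ─ S)
    go zero S S⊆W stag S<2m fuel≥ = contradiction fuel≥ (<⇒≱ S<2m)
    go (suc fuel) S S⊆W stag S<2m fuel≥
      with anySubset? (λ X → (X ⊆? (W ─ S)) ×-dec (1 ≤? ∣ X ∣) ×-dec (∣ X ∣ ≤? m) ×-dec
                             (∣ Γ X ∩ (W ─ S) ∣ <? 3 * ∣ X ∣))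
    ... | no none = S , S⊆W , S<2m , λ X X⊆ 1≤X X≤m → ≮⇒≥ λ small → none (X , X⊆ , 1≤X , X≤m , small)
    ... | yes (X , X⊆ , 1≤X , X≤m , small) =
      case 2 * m ≤? ∣ S ∪ X ∣ of λ
        { (no S∪X≱2m) → go fuel (S ∪ X) S∪X⊆W stag′ (≰⇒> S∪X≱2m) (begin
            2 * m                    ≤⟨ fuel≥ ⟩
            suc fuel + ∣ S ∣         ≡⟨ solve 2 (λ a b → con 1 :+ a :+ b := a :+ (b :+ con 1)) refl fuel ∣ S ∣ ⟩
            fuel + (∣ S ∣ + 1)       ≤⟨ +-monoʳ-≤ fuel (+-monoʳ-≤ ∣ S ∣ 1≤X) ⟩
            fuel + (∣ S ∣ + ∣ X ∣)   ≤⟨ +-monoʳ-≤ fuel disjoint-size ⟩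
            fuel + ∣ S ∪ X ∣         ∎)
        -- Since `∣ S ∣ < 2m` and `∣ X ∣ ≤ m`, the union has fewer than `3m` vertices and, being
        -- stagnant, fewer than `4 · 3m` neighbours in `W`. This is the source of the constant 12.
        ; (yes S∪X≥2m) → contradiction (large (S ∪ X) S∪X⊆W S∪X≥2m) (<⇒≱ (begin-strict
            ∣ Γ (S ∪ X) ∩ W ∣  ≤⟨ stagnant⇒∣Γ∩W∣≤ (S ∪ X) stag′ ⟩
            4 * ∣ S ∪ X ∣      ≤⟨ *-monoʳ-≤ 4 (∣p∪q∣≤∣p∣+∣q∣ S X) ⟩
            4 * (∣ S ∣ + ∣ X ∣) <⟨ *-monoʳ-< 4 (+-mono-<-≤ S<2m X≤m) ⟩
            4 * (2 * m + m)    ≡⟨ solve 1 (λ m → con 4 :* (con 2 :* m :+ m) := con 12 :* m) refl m ⟩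
            12 * m             ∎)) }
      where
      S∪X⊆W : S ∪ X ⊆ W
      S∪X⊆W x∈ = [ S⊆W , p─q⊆p W S ∘ X⊆ ] (x∈p∪q⁻ S X x∈)
      disjoint-size : ∣ S ∣ + ∣ X ∣ ≤ ∣ S ∪ X ∣
      disjoint-size = disjoint⇒∣p∣+∣q∣≤∣p∪q∣ S X λ x∈S x∈X → x∈p─q⇒x∉q W S (X⊆ x∈X) x∈S
      stag′ : Stagnant W (S ∪ X)
      stag′ = stagnant-∪ stag X⊆ (<⇒≤ small)

  -- The state of a breadth-first tree rooted at `v`: the current layer, the union of the earlier
  -- ones, and for each vertex of the layer its branch back to the root. Layers have exactly `2 ^ i`
  -- vertices, so that the earlier ones together stay below `2 ^ i`.
  record Level (W : Subset N) (v : Fin N) (i : ℕ) : Set where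
    field
      layer      : Subset N
      below      : Subset N
      layer⊆     : layer ⊆ W
      below⊆     : below ⊆ W
      layer-side : ∀ {y} → y ∈ layer → σ y ≡ flips i (σ v)
      ∣layer∣    : ∣ layer ∣ ≡ 2 ^ i
      ∣below∣    : ∣ below ∣ < 2 ^ i
      path       : ∀ {y} → y ∈ layer → Path (λ x → x ∈ below ⊎ x ≡ y) (suc i) y v

  firstLevel : ∀ {W v} → v ∈ W → Level W v 0
  firstLevel {W} {v} v∈W = record
    { layer      = ⁅ v ⁆
    ; below      = ∅
    ; layer⊆     = λ y∈ → subst (_∈ W) (sym (x∈⁅y⁆⇒x≡y v y∈)) v∈W
    ; below⊆     = ⊥⊆
    ; layer-side = λ y∈ → cong σ (x∈⁅y⁆⇒x≡y v y∈)
    ; ∣layer∣    = ∣⁅x⁆∣≡1 v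
    ; ∣below∣    = s≤s (≤-reflexive (∣⊥∣≡0 N))
    ; path       = λ y∈ → subst (λ z → Path (λ x → x ∈ ∅ ⊎ x ≡ z) 1 z v) (sym (x∈⁅y⁆⇒x≡y v y∈)) (end (inj₂ refl))
    }

  -- The layer has at least `3 · 2 ^ i` neighbours in `W`, of which fewer than `2 ^ i` lie in
  -- earlier layers. At least `2 ^ (i + 1)` fresh ones remain, and any surplus is discarded.
  nextLevel : ∀ {m W v i} → Expander m W → 2 ^ i ≤ m → Level W v i → Level W v (suc i)
  nextLevel {m} {W} {v} {i} expander 2^i≤m lev = record
    { layer      = new
    ; below      = below ∪ layer
    ; layer⊆     = λ y∈ → proj₂ (x∈p∩q⁻ (Γ layer) W (p─q⊆p _ below (new⊆ y∈)))
    ; below⊆     = λ y∈ → [ below⊆ , layer⊆ ] (x∈p∪q⁻ below layer y∈)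
    ; layer-side = λ y∈ → case parent y∈ of λ { (_ , x∈ , r) → trans (R-crosses r) (cong not (layer-side x∈)) }
    ; ∣layer∣    = ∣new∣
    ; ∣below∣    = begin-strict
        ∣ below ∪ layer ∣       ≤⟨ ∣p∪q∣≤∣p∣+∣q∣ below layer ⟩
        ∣ below ∣ + ∣ layer ∣   <⟨ +-mono-<-≤ ∣below∣ (≤-reflexive ∣layer∣) ⟩
        2 ^ i + 2 ^ i           ≡⟨ cong (2 ^ i +_) (+-identityʳ (2 ^ i)) ⟨
        2 ^ suc i               ∎
    ; path       = extend
    }
    where
    open Level lev
    candidates = (Γ layer ∩ W) ─ below

    enough : 2 ^ suc i ≤ ∣ candidates ∣
    enough = +-cancelʳ-≤ ∣ below ∣ _ _ (begin
      2 ^ suc i + ∣ below ∣         ≤⟨ +-monoʳ-≤ (2 ^ suc i) (<⇒≤ ∣below∣) ⟩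
      2 ^ suc i + 2 ^ i             ≡⟨ +-comm (2 ^ suc i) (2 ^ i) ⟩
      3 * 2 ^ i                     ≡⟨ cong (3 *_) ∣layer∣ ⟨
      3 * ∣ layer ∣                 ≤⟨ expander layer layer⊆
                                         (≤-trans (m^n>0 2 i) (≤-reflexive (sym ∣layer∣)))
                                         (≤-trans (≤-reflexive ∣layer∣) 2^i≤m) ⟩
      ∣ Γ layer ∩ W ∣               ≤⟨ ∣p∣≤∣p─q∣+∣q∣ (Γ layer ∩ W) below ⟩
      ∣ candidates ∣ + ∣ below ∣    ∎)

    shrunk = shrink candidates enough
    new = proj₁ shrunk
    new⊆ : new ⊆ candidates
    new⊆ = proj₁ (proj₂ shrunk)
    ∣new∣ : ∣ new ∣ ≡ 2 ^ suc i
    ∣new∣ = proj₂ (proj₂ shrunk)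

    parent : ∀ {y} → y ∈ new → ∃ λ x → x ∈ layer × R y x
    parent y∈ with x , x∈ , r ← ∈Γ⁻ layer (proj₁ (x∈p∩q⁻ (Γ layer) W (p─q⊆p _ below (new⊆ y∈)))) = x , x∈ , R-sym r

    extend : ∀ {y} → y ∈ new → Path (λ x → x ∈ below ∪ layer ⊎ x ≡ y) (suc (suc i)) y v
    extend {y} y∈ with x , x∈ , r ← parent y∈ = step (inj₂ refl) r (weaken
      (λ { (inj₁ z∈) → inj₁ (x∈p∪q⁺ (inj₁ z∈)) ,
                       λ { refl → x∈p─q⇒x∉q (Γ layer ∩ W) below (new⊆ y∈) z∈ }
         -- The parent `x` differs from `y` because an edge joins opposite sides.
         ; (inj₂ refl) → inj₁ (x∈p∪q⁺ (inj₂ x∈)) , λ { refl → not-¬ refl (R-crosses r) } })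
      (path x∈))

  grow : ∀ {m W v} d → Expander m W → (∀ {i} → i < d → 2 ^ i ≤ m) → v ∈ W → Level W v d
  grow zero    expander small v∈ = firstLevel v∈
  grow (suc d) expander small v∈ =
    nextLevel expander (small ≤-refl) (grow d expander (λ i<d → small (m<n⇒m<1+n i<d)) v∈)

  -- The path carried by the search may be empty, which `Path` itself does not allow.
  data Stack (P : Subset N) : ℕ → Set where
    nil  : Stack P 0
    some : ∀ {k u v} → Path (_∈ P) (suc k) u v → Stack P (suc k)

  pop : ∀ {P k u v} → Path (_∈ P) (suc k) u v → Stack (P - u) k
  pop (end _) = nil
  pop (step _ _ p@(end _))      = some (weaken (λ (x∈ , x≢) → x∈p∧x≢y⇒x∈p-y x∈ x≢) p)
  pop (step _ _ p@(step _ _ _)) = some (weaken (λ (x∈ , x≢) → x∈p∧x≢y⇒x∈p-y x∈ x≢) p)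

  push : ∀ {P k u v w} → w ∉ P → R w u → Path (_∈ P) k u v → Path (_∈ P ∪ ⁅ w ⁆) (suc k) w v
  push {P} {w = w} w∉P r p = step (x∈p∪q⁺ (inj₂ (x∈⁅x⁆ w))) r
    (weaken (λ x∈ → x∈p∪q⁺ (inj₁ x∈) , λ { refl → w∉P x∈ }) p)

  -- Depth-first search: P carries the current path, F the vertices already abandoned.
  exact-path : ∀ {s k W} → 1 ≤ k → s ≤ ∣ W ∣ → ExpandsLarge s (k + s) W → 1 ≤ s →
    ∃₂ λ u v → Path (_∈ W) k u v
  exact-path {s} {k} {W} 1≤k s≤W large 1≤s = go ∣ W ∣ 0 ∅ ∅ ⊥⊆ ⊥⊆ (λ x∈ → contradiction x∈ ∉⊥)
      (≤-trans (s≤s (≤-reflexive (∣⊥∣≡0 N))) 1≤s) (≤-reflexive (∣⊥∣≡0 N)) 1≤k nil (∣p─q∣≤∣p∣ W (∅ ∪ ∅))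
    where
    Goal = ∃₂ λ u v → Path (_∈ W) k u v

    ∪⁅⁆⊆W : ∀ {P w} → P ⊆ W → w ∈ W → P ∪ ⁅ w ⁆ ⊆ W
    ∪⁅⁆⊆W {P} {w} P⊆W w∈W x∈ =
      [ P⊆W , (λ x∈w → subst (_∈ W) (sym (x∈⁅y⁆⇒x≡y w x∈w)) w∈W) ] (x∈p∪q⁻ P ⁅ w ⁆ x∈)

    unseen-shrinks : ∀ {h w} P F → w ∈ W ─ (P ∪ F) → ∣ W ─ (P ∪ F) ∣ ≤ suc h →
      ∣ W ─ ((P ∪ ⁅ w ⁆) ∪ F) ∣ ≤ h
    unseen-shrinks {h} {w} P F w∈ ≤1+h = s≤s⁻¹ (≤-trans (p⊂q⇒∣p∣<∣q∣ (⊆′ , w , w∈ , w∉)) ≤1+h)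
      where
      ⊆′ : W ─ ((P ∪ ⁅ w ⁆) ∪ F) ⊆ W ─ (P ∪ F)
      ⊆′ x∈ = x∈p∧x∉q⇒x∈p─q (p─q⊆p W _ x∈) λ x∈P∪F → x∈p─q⇒x∉q W _ x∈
        (x∈p∪q⁺ (case x∈p∪q⁻ P F x∈P∪F of λ
          { (inj₁ x∈P) → inj₁ (p⊆p∪q ⁅ w ⁆ x∈P) ; (inj₂ x∈F) → inj₂ x∈F }))
      w∉ : w ∉ W ─ ((P ∪ ⁅ w ⁆) ∪ F)
      w∉ w∈′ = x∈p─q⇒x∉q W _ w∈′ (p⊆p∪q F (q⊆p∪q P ⁅ w ⁆ (x∈⁅x⁆ w)))

    -- The pair `(h , l)` decreases lexicographically: extending the path lowers the bound `h` on
    -- unseen vertices, and backtracking keeps `h` and shortens the path. The closure hypothesis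
    -- says that an abandoned vertex has no unseen neighbour.
    go : ∀ h l F P → F ⊆ W → P ⊆ W → (∀ {x y} → x ∈ F → R x y → y ∈ W → y ∈ P ∪ F) →
      ∣ F ∣ < s → ∣ P ∣ ≤ l → l < k → Stack P l → ∣ W ─ (P ∪ F) ∣ ≤ h → Goal

    advance : ∀ h l F P {w v} → w ∈ W ─ (P ∪ F) → Path (_∈ P ∪ ⁅ w ⁆) (suc l) w v →
      F ⊆ W → P ⊆ W → (∀ {x y} → x ∈ F → R x y → y ∈ W → y ∈ P ∪ F) →
      ∣ F ∣ < s → ∣ P ∣ ≤ l → l < k → ∣ W ─ (P ∪ F) ∣ ≤ h → Goal

    go h zero F P F⊆W P⊆W closed F<s P≤0 0<k nil ≤h with nonempty? (W ─ (P ∪ F))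
    ... | yes (w , w∈) =
      advance h 0 F P w∈ (end (x∈p∪q⁺ (inj₂ (x∈⁅x⁆ w)))) F⊆W P⊆W closed F<s P≤0 0<k ≤h
    -- With an empty path and nothing unseen, `W` would be covered by `F`, which has fewer than `s`
    -- vertices.
    ... | no none = contradiction s≤W (<⇒≱ (begin-strict
      ∣ W ∣         ≤⟨ ⊆∪⇒∣∣≤ P F (λ {x} x∈W → case x ∈? (P ∪ F) of λ
                         { (yes x∈) → x∈
                         ; (no x∉) → contradiction (x , x∈p∧x∉q⇒x∈p─q x∈W x∉) none }) ⟩
      ∣ P ∣ + ∣ F ∣ ≤⟨ +-monoˡ-≤ ∣ F ∣ P≤0 ⟩
      ∣ F ∣         <⟨ F<s ⟩
      s             ∎))
    go h (suc l) F P F⊆W P⊆W closed F<s P≤l l<k (some {u = u} p) ≤h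
      with any? (λ w → w ∈? (W ─ (P ∪ F)) ×-dec R? w u)
    ... | yes (w , w∈ , r) =
      advance h (suc l) F P w∈ (push (λ w∈P → x∈p─q⇒x∉q W _ w∈ (p⊆p∪q F w∈P)) r p)
        F⊆W P⊆W closed F<s P≤l l<k ≤h
    ... | no none = case s ≤? ∣ F ∪ ⁅ u ⁆ ∣ of λ
        { (no ≱s) → go h l (F ∪ ⁅ u ⁆) (P - u) F′⊆W (P⊆W ∘ p─q⊆p P ⁅ u ⁆) closed′ (≰⇒> ≱s) P-u≤l
                      (<-trans ≤-refl l<k) (pop p) (≤-trans (p⊆q⇒∣p∣≤∣q∣ unseen⊆) ≤h)
        -- Now `F ∪ ⁅ u ⁆` has at most `s` vertices, and all its neighbours in `W` lie in it or on
        -- the shortened path. That is fewer than `k + s`, against the expansion of large sets.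
        ; (yes ≥s) → contradiction (large (F ∪ ⁅ u ⁆) F′⊆W ≥s) (<⇒≱ (begin-strict
            ∣ Γ (F ∪ ⁅ u ⁆) ∩ W ∣       ≤⟨ ⊆∪⇒∣∣≤ (P - u) (F ∪ ⁅ u ⁆) Γ⊆ ⟩
            ∣ P - u ∣ + ∣ F ∪ ⁅ u ⁆ ∣   ≤⟨ +-mono-≤ P-u≤l (≤-trans (∣p∪⁅x⁆∣≤1+∣p∣ F u) F<s) ⟩
            l + s                       <⟨ +-monoˡ-< s (<-trans ≤-refl l<k) ⟩
            k + s                       ∎)) }
      where
      u∈P : u ∈ P
      u∈P = source∈ p

      P-u≤l : ∣ P - u ∣ ≤ l
      P-u≤l = s≤s⁻¹ (≤-trans (x∈p⇒∣p-x∣<∣p∣ u∈P) P≤l)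

      F′⊆W : F ∪ ⁅ u ⁆ ⊆ W
      F′⊆W = ∪⁅⁆⊆W F⊆W (P⊆W u∈P)

      move : P ∪ F ⊆ (P - u) ∪ (F ∪ ⁅ u ⁆)
      move {x} x∈ = x∈p∪q⁺ (case x∈p∪q⁻ P F x∈ of λ
        { (inj₂ x∈F) → inj₂ (p⊆p∪q ⁅ u ⁆ x∈F)
        ; (inj₁ x∈P) → case x ≟ᶠ u of λ
          { (yes refl) → inj₂ (q⊆p∪q F ⁅ u ⁆ (x∈⁅x⁆ u))
          ; (no x≢u)   → inj₁ (x∈p∧x≢y⇒x∈p-y x∈P x≢u) } })

      closed′ : ∀ {x y} → x ∈ F ∪ ⁅ u ⁆ → R x y → y ∈ W → y ∈ (P - u) ∪ (F ∪ ⁅ u ⁆)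
      closed′ {x} {y} x∈ r y∈W = move (case x∈p∪q⁻ F ⁅ u ⁆ x∈ of λ
        { (inj₁ x∈F) → closed x∈F r y∈W
        ; (inj₂ x∈u) → case y ∈? (P ∪ F) of λ
          { (yes y∈) → y∈
          ; (no y∉) → contradiction
              (y , x∈p∧x∉q⇒x∈p─q y∈W y∉ , R-sym (subst (λ z → R z y) (x∈⁅y⁆⇒x≡y u x∈u) r)) none } })

      Γ⊆ : Γ (F ∪ ⁅ u ⁆) ∩ W ⊆ (P - u) ∪ (F ∪ ⁅ u ⁆)
      Γ⊆ y∈ with y∈Γ , y∈W ← x∈p∩q⁻ (Γ (F ∪ ⁅ u ⁆)) W y∈
            with x , x∈ , r ← ∈Γ⁻ (F ∪ ⁅ u ⁆) y∈Γ = closed′ x∈ r y∈W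

      unseen⊆ : W ─ ((P - u) ∪ (F ∪ ⁅ u ⁆)) ⊆ W ─ (P ∪ F)
      unseen⊆ x∈ = x∈p∧x∉q⇒x∈p─q (p─q⊆p W _ x∈) (x∈p─q⇒x∉q W _ x∈ ∘ move)

    advance zero l F P w∈ p F⊆W P⊆W closed F<s P≤l l<k ≤0 = contradiction ≤0 (<⇒≱ (x∈p⇒0<∣p∣ w∈))
    advance (suc h) l F P {w} w∈ p F⊆W P⊆W closed F<s P≤l l<k ≤1+h with suc l ≟ k
    ... | yes refl = _ , _ , weaken (∪⁅⁆⊆W P⊆W (p─q⊆p W _ w∈)) p
    ... | no l+1≢k = go h (suc l) F (P ∪ ⁅ w ⁆) F⊆W
        (∪⁅⁆⊆W P⊆W (p─q⊆p W _ w∈))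
        (λ x∈ r y∈ → x∈p∪q⁺ (case x∈p∪q⁻ P F (closed x∈ r y∈) of λ
          { (inj₁ y∈P) → inj₁ (p⊆p∪q ⁅ w ⁆ y∈P) ; (inj₂ y∈F) → inj₂ y∈F }))
        F<s (≤-trans (∣p∪⁅x⁆∣≤1+∣p∣ P w) (s≤s P≤l)) (≤∧≢⇒< l<k l+1≢k) (some p) (unseen-shrinks P F w∈ ≤1+h)

-- Dense bipartite graphs

not-swap : ∀ {a b} → a ≡ not b → b ≡ not a
not-swap {b = b} refl = sym (not-involutive b)

-- The hypothesis `joined` is the form in which the absence of a blue complete bipartite graph
-- enters. It holds for both values of `b`, so the smaller set may lie on either side.
module Dense {N : ℕ} (R : Fin N → Fin N → Set) (R? : ∀ x y → Dec (R x y))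
  (R-sym : ∀ {x y} → R x y → R y x)
  (σ : Fin N → Bool) (R-crosses : ∀ {x y} → R x y → σ x ≡ not (σ y))
  (U : Subset N) (m M : ℕ) (1≤m : 1 ≤ m)
  (joined : ∀ b {X Y : Subset N} → X ⊆ U → Y ⊆ U →
    (∀ {x} → x ∈ X → σ x ≡ b) → (∀ {y} → y ∈ Y → σ y ≡ not b) →
    m ≤ ∣ X ∣ → M ≤ ∣ Y ∣ → ∃₂ λ x y → x ∈ X × y ∈ Y × R x y) where

  open Bipartite R R? R-sym σ R-crosses public

  side : Bool → Subset N
  side b = ⟦ (λ x → σ x ≟ᵇ b) ⟧

  ∈side⁺ : ∀ {x} → x ∈ side (σ x)
  ∈side⁺ {x} = ∈⟦⟧⁺ (λ z → σ z ≟ᵇ σ x) refl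

  ∈side⁻ : ∀ b {x} → x ∈ side b → σ x ≡ b
  ∈side⁻ b = ∈⟦⟧⁻ (λ z → σ z ≟ᵇ b)

  Balanced : ℕ → Subset N → Set
  Balanced k W = ∀ b → k ≤ ∣ W ∩ side b ∣

  balanced⇒≤∣∣ : ∀ {k W} → Balanced k W → k ≤ ∣ W ∣
  balanced⇒≤∣∣ {W = W} bal = ≤-trans (bal true) (∣p∩q∣≤∣p∣ W (side true))

  -- The bound concerns `S ∩ W` rather than `S`, because `S` will often be a neighbourhood that
  -- reaches outside `W`.
  balanced-─ : ∀ {k l W} S → Balanced (k + l) W → ∣ S ∩ W ∣ ≤ l → Balanced k (W ─ S)
  balanced-─ {k} {l} {W} S bal S≤l b = +-cancelʳ-≤ l _ _ (begin
    k + l                                ≤⟨ bal b ⟩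
    ∣ W ∩ side b ∣                       ≤⟨ ⊆∪⇒∣∣≤ ((W ─ S) ∩ side b) (S ∩ W) ⊆∪ ⟩
    ∣ (W ─ S) ∩ side b ∣ + ∣ S ∩ W ∣     ≤⟨ +-monoʳ-≤ _ S≤l ⟩
    ∣ (W ─ S) ∩ side b ∣ + l             ∎)
    where
    ⊆∪ : W ∩ side b ⊆ ((W ─ S) ∩ side b) ∪ (S ∩ W)
    ⊆∪ {x} x∈ with x∈W , x∈b ← x∈p∩q⁻ W (side b) x∈ = x∈p∪q⁺ (case x ∈? S of λ
      { (yes x∈S) → inj₂ (x∈p∩q⁺ (x∈S , x∈W))
      ; (no x∉S)  → inj₁ (x∈p∩q⁺ (x∈p∧x∉q⇒x∈p─q x∈W x∉S , x∈b)) })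

  split : ∀ {k l W} → Balanced (k + l) W →
    ∃₂ λ W₁ W₂ → W₁ ⊆ W × W₂ ⊆ W × Disjoint W₁ W₂ × Balanced k W₁ × Balanced l W₂
  split {k} {l} {W} bal =
    W₁ , W ─ W₁ , W₁⊆W , p─q⊆p W W₁ , (λ x∈W₁ x∈W₂ → x∈p─q⇒x∉q W W₁ x∈W₂ x∈W₁) , bal₁ , bal₂
    where
    half : ∀ b → ∃ λ T → T ⊆ W ∩ side b × ∣ T ∣ ≡ k
    half b = shrink (W ∩ side b) (≤-trans (m≤m+n k l) (bal b))

    T : Bool → Subset N
    T b = proj₁ (half b)
    T⊆W : ∀ b → T b ⊆ W
    T⊆W b x∈ = proj₁ (x∈p∩q⁻ W (side b) (proj₁ (proj₂ (half b)) x∈))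
    T⊆side : ∀ b → T b ⊆ side b
    T⊆side b x∈ = proj₂ (x∈p∩q⁻ W (side b) (proj₁ (proj₂ (half b)) x∈))
    ∣T∣ : ∀ b → ∣ T b ∣ ≡ k
    ∣T∣ b = proj₂ (proj₂ (half b))

    W₁ : Subset N
    W₁ = T true ∪ T false

    W₁⊆W : W₁ ⊆ W
    W₁⊆W x∈ = [ T⊆W true , T⊆W false ] (x∈p∪q⁻ (T true) (T false) x∈)

    T⊆W₁ : ∀ b → T b ⊆ W₁
    T⊆W₁ true  = p⊆p∪q (T false)
    T⊆W₁ false = q⊆p∪q (T true) (T false)

    W₁∩side⊆T : ∀ b → W₁ ∩ side b ⊆ T b
    W₁∩side⊆T b x∈ with x∈W₁ , x∈b ← x∈p∩q⁻ W₁ (side b) x∈ with x∈p∪q⁻ (T true) (T false) x∈W₁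
    ... | inj₁ x∈T = subst (λ c → _ ∈ T c) (trans (sym (∈side⁻ true (T⊆side true x∈T))) (∈side⁻ b x∈b)) x∈T
    ... | inj₂ x∈T = subst (λ c → _ ∈ T c) (trans (sym (∈side⁻ false (T⊆side false x∈T))) (∈side⁻ b x∈b)) x∈T

    bal₁ : Balanced k W₁
    bal₁ b = ≤-trans (≤-reflexive (sym (∣T∣ b))) (p⊆q⇒∣p∣≤∣q∣ λ x∈ → x∈p∩q⁺ (T⊆W₁ b x∈ , T⊆side b x∈))

    bal₂ : Balanced l (W ─ W₁)
    bal₂ b = +-cancelˡ-≤ k _ _ (begin
      k + l                                        ≤⟨ bal b ⟩
      ∣ W ∩ side b ∣                               ≤⟨ ⊆∪⇒∣∣≤ (T b) ((W ─ W₁) ∩ side b) ⊆∪ ⟩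
      ∣ T b ∣ + ∣ (W ─ W₁) ∩ side b ∣              ≡⟨ cong (_+ ∣ (W ─ W₁) ∩ side b ∣) (∣T∣ b) ⟩
      k + ∣ (W ─ W₁) ∩ side b ∣                    ∎)
      where
      ⊆∪ : W ∩ side b ⊆ T b ∪ ((W ─ W₁) ∩ side b)
      ⊆∪ {x} x∈ with x∈W , x∈b ← x∈p∩q⁻ W (side b) x∈ = x∈p∪q⁺ (case x ∈? W₁ of λ
        { (yes x∈W₁) → inj₁ (W₁∩side⊆T b (x∈p∩q⁺ (x∈W₁ , x∈b)))
        ; (no x∉W₁)  → inj₂ (x∈p∩q⁺ (x∈p∧x∉q⇒x∈p─q x∈W x∉W₁ , x∈b)) })

  -- By pigeonhole `S` has `m` vertices on one side, and `T` has `M` on the other.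
  joined-balanced : ∀ {S T} → S ⊆ U → T ⊆ U → 2 * m ≤ ∣ S ∣ → Balanced M T →
    ∃₂ λ x y → x ∈ S × y ∈ T × R x y
  joined-balanced {S} {T} S⊆U T⊆U 2m≤S bal = case m ≤? ∣ S ∩ side true ∣ of λ
    { (yes m≤) → fromSide true m≤
    ; (no ≱) → fromSide false (+-cancelˡ-≤ m _ _ (begin
        m + m                                     ≡⟨ cong (m +_) (+-identityʳ m) ⟨
        2 * m                                     ≤⟨ 2m≤S ⟩
        ∣ S ∣                                     ≤⟨ ⊆∪⇒∣∣≤ (S ∩ side true) (S ∩ side false) ⊆∪ ⟩
        ∣ S ∩ side true ∣ + ∣ S ∩ side false ∣    ≤⟨ +-monoˡ-≤ _ (<⇒≤ (≰⇒> ≱)) ⟩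
        m + ∣ S ∩ side false ∣                    ∎)) }
    where
    fromSide : ∀ b → m ≤ ∣ S ∩ side b ∣ → ∃₂ λ x y → x ∈ S × y ∈ T × R x y
    fromSide b m≤ with x , y , x∈ , y∈ , r ← joined b {S ∩ side b} {T ∩ side (not b)}
        (S⊆U ∘ p∩q⊆p S (side b)) (T⊆U ∘ p∩q⊆p T (side (not b)))
        (∈side⁻ b ∘ p∩q⊆q S (side b)) (∈side⁻ (not b) ∘ p∩q⊆q T (side (not b))) m≤ (bal (not b))
      = x , y , p∩q⊆p S (side b) x∈ , p∩q⊆p T (side (not b)) y∈ , r

    ⊆∪ : S ⊆ (S ∩ side true) ∪ (S ∩ side false)
    ⊆∪ {x} x∈ with σ x | ∈side⁺ {x}
    ... | true  | x∈b = x∈p∪q⁺ (inj₁ (x∈p∩q⁺ (x∈ , x∈b)))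
    ... | false | x∈b = x∈p∪q⁺ (inj₂ (x∈p∩q⁺ (x∈ , x∈b)))

  -- If `S` had fewer than `k` neighbours in `W`, deleting them would leave `M` vertices on each
  -- side and no edge from `S` to any of these.
  balanced⇒expandsLarge : ∀ {k W} → W ⊆ U → Balanced (M + k) W → ExpandsLarge (2 * m) k W
  balanced⇒expandsLarge {k} {W} W⊆U bal S S⊆W 2m≤S = ≮⇒≥ λ Γ<k →
    case joined-balanced (W⊆U ∘ S⊆W) (W⊆U ∘ p─q⊆p W (Γ S)) 2m≤S (balanced-─ (Γ S) bal (<⇒≤ Γ<k)) of λ
      (x , y , x∈S , y∈ , r) → x∈p─q⇒x∉q W (Γ S) y∈ (∈Γ⁺ x∈S r)

  -- The surplus `12 * m` serves twice: it gives the expansion that `expander-core` needs, and it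
  -- pays for the fewer than `2 * m` vertices deleted there.
  core : ∀ {W} → W ⊆ U → Balanced (M + 12 * m) W → ∃ λ W′ → W′ ⊆ W × Expander m W′ × Balanced M W′
  core {W} W⊆U bal
    with S , S⊆W , S<2m , expander ← expander-core m W 1≤m (balanced⇒expandsLarge W⊆U bal)
    = W ─ S , p─q⊆p W S , expander , balanced-─ S bal (begin
        ∣ S ∩ W ∣ ≤⟨ ∣p∩q∣≤∣p∣ S W ⟩
        ∣ S ∣     ≤⟨ <⇒≤ S<2m ⟩
        2 * m     ≤⟨ *-monoˡ-≤ m {2} {12} (s≤s (s≤s z≤n)) ⟩
        12 * m    ∎)

  -- Fewer than `2 * m` vertices of `W` have no neighbour in `T`, since `2 * m` of them would be
  -- joined to `T`.
  removeUnattached : ∀ {k W T} → W ⊆ U → T ⊆ U → Balanced (k + 2 * m) W → Balanced M T →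
    ∃ λ W′ → W′ ⊆ W × Balanced k W′ × (∀ {x} → x ∈ W′ → ∃ λ y → y ∈ T × R x y)
  removeUnattached {k} {W} {T} W⊆U T⊆U balW balT =
    W ─ lone , p─q⊆p W lone ,
    balanced-─ lone balW (≤-trans (∣p∩q∣≤∣p∣ lone W) (<⇒≤ (≰⇒> lone≱2m))) , attached
    where
    lone : Subset N
    lone = W ─ Γ T

    lone≱2m : ¬ (2 * m ≤ ∣ lone ∣)
    lone≱2m 2m≤ with x , y , x∈ , y∈ , r ← joined-balanced (W⊆U ∘ p─q⊆p W (Γ T)) T⊆U 2m≤ balT
      = x∈p─q⇒x∉q W (Γ T) x∈ (∈Γ⁺ y∈ (R-sym r))

    attached : ∀ {x} → x ∈ W ─ lone → ∃ λ y → y ∈ T × R x y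
    attached {x} x∈ with x ∈? Γ T
    ... | yes x∈Γ with y , y∈T , r ← ∈Γ⁻ T x∈Γ = y , y∈T , R-sym r
    ... | no x∉Γ = contradiction (x∈p∧x∉q⇒x∈p─q (p─q⊆p W lone x∈) x∉Γ) (x∈p─q⇒x∉q W lone x∈)

  -- Otherwise `E ─ Γ L` would keep `M` vertices on the side opposite to `L`, and `joined` would
  -- give an edge from `L` to one of them.
  ∣Γ∩∣-large : ∀ b {L E} → L ⊆ U → E ⊆ U → (∀ {x} → x ∈ L → σ x ≡ b) → m ≤ ∣ L ∣ →
    Balanced (M + M) E → M ≤ ∣ Γ L ∩ E ∣
  ∣Γ∩∣-large b {L} {E} L⊆U E⊆U L-side m≤L bal = ≮⇒≥ λ small →
    case joined b {L} {(E ─ Γ L) ∩ side (not b)} L⊆U (E⊆U ∘ p─q⊆p E (Γ L) ∘ p∩q⊆p (E ─ Γ L) (side (not b)))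
           L-side (∈side⁻ (not b) ∘ p∩q⊆q (E ─ Γ L) (side (not b))) m≤L
           (balanced-─ (Γ L) bal (<⇒≤ small) (not b)) of λ
      (x , y , x∈L , y∈ , r) → x∈p─q⇒x∉q E (Γ L) (p∩q⊆p (E ─ Γ L) (side (not b)) y∈) (∈Γ⁺ x∈L r)

  -- Both end sets have size at least `M`, so each can serve as either part of the forbidden blue
  -- graph when a cycle is closed.
  record Connector (k : ℕ) : Set where
    field
      X Y    : Subset N
      b      : Bool
      X⊆U    : X ⊆ U
      Y⊆U    : Y ⊆ U
      X-side : ∀ {x} → x ∈ X → σ x ≡ b
      Y-side : ∀ {y} → y ∈ Y → σ y ≡ not b
      M≤∣X∣  : M ≤ ∣ X ∣
      M≤∣Y∣  : M ≤ ∣ Y ∣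
      path   : ∀ {x y} → x ∈ X → y ∈ Y → Path (_∈ U) k x y

  -- The four reserved pieces: `W` holds the path of prescribed order, `C₂` and `C₃` the trees grown
  -- from its ends, and `E` the final end sets. Every vertex of `W` is attached to both expanders
  -- because the search does not control where its path ends.
  record Frame (k : ℕ) : Set where
    field
      E C₂ C₃ W : Subset N
      E⊆U       : E ⊆ U
      C₂⊆U      : C₂ ⊆ U
      C₃⊆U      : C₃ ⊆ U
      W⊆U       : W ⊆ U
      E#C₂      : Disjoint E C₂
      E#C₃      : Disjoint E C₃
      E#W       : Disjoint E W
      C₂#C₃     : Disjoint C₂ C₃
      C₂#W      : Disjoint C₂ W
      C₃#W      : Disjoint C₃ W
      balE      : Balanced (M + M) E
      expander₂ : Expander m C₂
      expander₃ : Expander m C₃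
      balW      : Balanced k W
      to₂       : ∀ {x} → x ∈ W → ∃ λ y → y ∈ C₂ × R x y
      to₃       : ∀ {x} → x ∈ W → ∃ λ y → y ∈ C₃ × R x y

  -- The summands are, in order, the shares of `E`, `C₂`, `C₃` and `W`; the two extra `2 * m` pay
  -- for the vertices of `W` not attached to `C₂` or to `C₃`.
  frame : ∀ {k} → let c = M + 12 * m in Balanced ((M + M) + (c + (c + (k + 2 * m + 2 * m)))) U → Frame k
  frame bal =
    let E , V₁ , E⊆U , V₁⊆U , E#V₁ , balE , balV₁ = split bal
        W₂ , V₂ , W₂⊆V₁ , V₂⊆V₁ , W₂#V₂ , balW₂ , balV₂ = split balV₁
        W₃ , W₁ , W₃⊆V₂ , W₁⊆V₂ , W₃#W₁ , balW₃ , balW₁ = split balV₂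
        C₂ , C₂⊆W₂ , exp₂ , balC₂ = core (λ x∈ → V₁⊆U (W₂⊆V₁ x∈)) balW₂
        C₃ , C₃⊆W₃ , exp₃ , balC₃ = core (λ x∈ → V₁⊆U (V₂⊆V₁ (W₃⊆V₂ x∈))) balW₃
        W₁′ , W₁′⊆ , balW₁′ , to₂ = removeUnattached (λ x∈ → V₁⊆U (V₂⊆V₁ (W₁⊆V₂ x∈)))
                                      (λ x∈ → V₁⊆U (W₂⊆V₁ (C₂⊆W₂ x∈))) balW₁ balC₂
        W₁″ , W₁″⊆ , balW₁″ , to₃ = removeUnattached (λ x∈ → V₁⊆U (V₂⊆V₁ (W₁⊆V₂ (W₁′⊆ x∈))))
                                      (λ x∈ → V₁⊆U (V₂⊆V₁ (W₃⊆V₂ (C₃⊆W₃ x∈)))) balW₁′ balC₃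
    in record
    { E = E ; C₂ = C₂ ; C₃ = C₃ ; W = W₁″
    ; E⊆U  = E⊆U
    ; C₂⊆U = λ x∈ → V₁⊆U (W₂⊆V₁ (C₂⊆W₂ x∈))
    ; C₃⊆U = λ x∈ → V₁⊆U (V₂⊆V₁ (W₃⊆V₂ (C₃⊆W₃ x∈)))
    ; W⊆U  = λ x∈ → V₁⊆U (V₂⊆V₁ (W₁⊆V₂ (W₁′⊆ (W₁″⊆ x∈))))
    ; E#C₂ = λ x∈E x∈ → E#V₁ x∈E (W₂⊆V₁ (C₂⊆W₂ x∈))
    ; E#C₃ = λ x∈E x∈ → E#V₁ x∈E (V₂⊆V₁ (W₃⊆V₂ (C₃⊆W₃ x∈)))
    ; E#W  = λ x∈E x∈ → E#V₁ x∈E (V₂⊆V₁ (W₁⊆V₂ (W₁′⊆ (W₁″⊆ x∈))))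
    ; C₂#C₃ = λ x∈C₂ x∈ → W₂#V₂ (C₂⊆W₂ x∈C₂) (W₃⊆V₂ (C₃⊆W₃ x∈))
    ; C₂#W  = λ x∈C₂ x∈ → W₂#V₂ (C₂⊆W₂ x∈C₂) (W₁⊆V₂ (W₁′⊆ (W₁″⊆ x∈)))
    ; C₃#W  = λ x∈C₃ x∈ → W₃#W₁ (C₃⊆W₃ x∈C₃) (W₁′⊆ (W₁″⊆ x∈))
    ; balE = balE
    ; expander₂ = exp₂
    ; expander₃ = exp₃
    ; balW = balW₁″
    ; to₂  = λ x∈ → to₂ (W₁″⊆ x∈)
    ; to₃  = to₃
    }

  module _ {k} (fr : Frame k) where
    open Frame fr

    module _ {i a c r₂ r₃} (p : Path (_∈ W) (2 + (i + i)) a c)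
      (r₂∈ : r₂ ∈ C₂) (a~r₂ : R a r₂) (r₃∈ : r₃ ∈ C₃) (c~r₃ : R c r₃)
      (d : ℕ) (m≤2^d : m ≤ 2 ^ d) (small : ∀ {j} → j < d → 2 ^ j ≤ m) where

      private
        module L₂ = Level (grow d expander₂ small r₂∈)
        module L₃ = Level (grow d expander₃ small r₃∈)

      -- The path has an even number of vertices, so its ends lie on opposite sides, and hence so do
      -- their neighbours `r₂` and `r₃`. Trees of equal depth carry this over to the end sets.
      roots-opposite : σ r₃ ≡ not (σ r₂)
      roots-opposite = trans (not-swap (R-crosses c~r₃)) (cong not (sym (trans (not-swap (R-crosses a~r₂))
        (trans (cong not (path-parity p)) (trans (not-involutive _) (flips-even i (σ c)))))))

      Xs : ∀ {x} → x ∈ Γ L₂.layer ∩ E → σ x ≡ not (flips d (σ r₂))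
      Xs x∈ with y , y∈ , r ← ∈Γ⁻ L₂.layer (p∩q⊆p (Γ L₂.layer) E x∈) =
        trans (not-swap (R-crosses r)) (cong not (L₂.layer-side y∈))

      Ys : ∀ {x} → x ∈ Γ L₃.layer ∩ E → σ x ≡ not (not (flips d (σ r₂)))
      Ys x∈ with y , y∈ , r ← ∈Γ⁻ L₃.layer (p∩q⊆p (Γ L₃.layer) E x∈) =
        trans (not-swap (R-crosses r)) (cong not
          (trans (L₃.layer-side y∈) (trans (cong (flips d) roots-opposite) (flips-not d (σ r₂)))))

      leaf₂ : ∀ {y} → y ∈ L₂.layer → Path (_∈ C₂) (suc d) y r₂
      leaf₂ y∈ = weaken [ L₂.below⊆ , (λ { refl → L₂.layer⊆ y∈ }) ] (L₂.path y∈)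

      leaf₃ : ∀ {y} → y ∈ L₃.layer → Path (_∈ C₃) (suc d) r₃ y
      leaf₃ y∈ = reverse R-sym (weaken [ L₃.below⊆ , (λ { refl → L₃.layer⊆ y∈ }) ] (L₃.path y∈))

      connect : ∀ {x y} → x ∈ Γ L₂.layer ∩ E → y ∈ Γ L₃.layer ∩ E →
        Path (_∈ U) (1 + (suc d + (2 + (i + i) + (suc d + 1)))) x y
      connect {x} {y} x∈ y∈
        with x′ , x′∈ , x′~x ← ∈Γ⁻ L₂.layer (p∩q⊆p (Γ L₂.layer) E x∈)
        with y′ , y′∈ , y′~y ← ∈Γ⁻ L₃.layer (p∩q⊆p (Γ L₃.layer) E y∈)
        = weaken all⊆U
            -- The order is `x`, the branch to `r₂`, the path `p`, the branch from `r₃`, then `y`.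
            (append x#rest (end {S = _≡ x} refl) (R-sym x′~x)
            (append C₂#rest (leaf₂ x′∈) (R-sym a~r₂)
            (append W#rest p c~r₃
            (append C₃#rest (leaf₃ y′∈) y′~y (end {S = _≡ y} refl)))))
        where
        x∈E = p∩q⊆q (Γ L₂.layer) E x∈
        y∈E = p∩q⊆q (Γ L₃.layer) E y∈

        C₃#rest : ∀ {z} → z ∈ C₃ → z ≡ y → ⊥
        C₃#rest z∈ refl = E#C₃ y∈E z∈

        W#rest : ∀ {z} → z ∈ W → z ∈ C₃ ⊎ z ≡ y → ⊥
        W#rest z∈ (inj₁ z∈C₃) = C₃#W z∈C₃ z∈
        W#rest z∈ (inj₂ refl) = E#W y∈E z∈

        C₂#rest : ∀ {z} → z ∈ C₂ → z ∈ W ⊎ (z ∈ C₃ ⊎ z ≡ y) → ⊥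
        C₂#rest z∈ (inj₁ z∈W)        = C₂#W z∈ z∈W
        C₂#rest z∈ (inj₂ (inj₁ z∈C₃)) = C₂#C₃ z∈ z∈C₃
        C₂#rest z∈ (inj₂ (inj₂ refl)) = E#C₂ y∈E z∈

        x#rest : ∀ {z} → z ≡ x → z ∈ C₂ ⊎ (z ∈ W ⊎ (z ∈ C₃ ⊎ z ≡ y)) → ⊥
        x#rest refl (inj₁ z∈)               = E#C₂ x∈E z∈
        x#rest refl (inj₂ (inj₁ z∈))        = E#W x∈E z∈
        x#rest refl (inj₂ (inj₂ (inj₁ z∈))) = E#C₃ x∈E z∈
        -- Both ends lie in `E`, so only their opposite sides keep them apart.
        x#rest refl (inj₂ (inj₂ (inj₂ refl))) = not-¬ refl (trans (sym (Xs x∈)) (Ys y∈))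

        all⊆U : ∀ {z} → z ≡ x ⊎ (z ∈ C₂ ⊎ (z ∈ W ⊎ (z ∈ C₃ ⊎ z ≡ y))) → z ∈ U
        all⊆U (inj₁ refl) = E⊆U x∈E
        all⊆U (inj₂ (inj₁ z∈)) = C₂⊆U z∈
        all⊆U (inj₂ (inj₂ (inj₁ z∈))) = W⊆U z∈
        all⊆U (inj₂ (inj₂ (inj₂ (inj₁ z∈)))) = C₃⊆U z∈
        all⊆U (inj₂ (inj₂ (inj₂ (inj₂ refl)))) = E⊆U y∈E

      assemble : Connector (1 + (suc d + (2 + (i + i) + (suc d + 1))))
      assemble = record
        { X      = Γ L₂.layer ∩ E
        ; Y      = Γ L₃.layer ∩ E
        ; b      = not (flips d (σ r₂))
        ; X⊆U    = E⊆U ∘ p∩q⊆q (Γ L₂.layer) E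
        ; Y⊆U    = E⊆U ∘ p∩q⊆q (Γ L₃.layer) E
        ; X-side = Xs
        ; Y-side = Ys
        ; M≤∣X∣  = ∣Γ∩∣-large _ (C₂⊆U ∘ L₂.layer⊆) E⊆U L₂.layer-side (≤-trans m≤2^d (≤-reflexive (sym L₂.∣layer∣))) balE
        ; M≤∣Y∣  = ∣Γ∩∣-large _ (C₃⊆U ∘ L₃.layer⊆) E⊆U L₃.layer-side (≤-trans m≤2^d (≤-reflexive (sym L₃.∣layer∣))) balE
        ; path   = connect
        }

  -- The search for a path on `ℓ` vertices uses `s = 2 * m` and needs such sets to have `ℓ + 2 * m`
  -- neighbours, whence the share `M + (ℓ + 2 * m)` of `W`. The resulting order is `2d + 6 + 2i`.
  connector : ∀ d i → m ≤ 2 ^ d → (∀ {j} → j < d → 2 ^ j ≤ m) →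
    let ℓ = 2 + (i + i); c = M + 12 * m in
    Balanced ((M + M) + (c + (c + ((M + (ℓ + 2 * m)) + 2 * m + 2 * m)))) U →
    Connector (1 + (suc d + (ℓ + (suc d + 1))))
  connector d i m≤2^d small bal =
    let fr = frame bal
        open Frame fr
        a , c , p = exact-path {s = 2 * m} {k = 2 + (i + i)} {W = W} (s≤s z≤n)
          (≤-trans (≤-trans (m≤n+m (2 * m) (2 + (i + i))) (m≤n+m _ M)) (balanced⇒≤∣∣ {W = W} balW))
          (balanced⇒expandsLarge W⊆U balW)
          (≤-trans 1≤m (m≤m+n m _))
        r₂ , r₂∈ , a~r₂ = to₂ (source∈ p)
        r₃ , r₃∈ , c~r₃ = to₃ (source∈ (reverse R-sym p))
    in assemble fr {i = i} p r₂∈ a~r₂ r₃∈ c~r₃ d m≤2^d small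

-- Decidability of the arrow relation

-- Embeddings and colourings are maps out of finite sets; they are searched through their tables, as
-- vectors.
Searchable : Set → Set₁
Searchable A = {P : A → Set} → Decidable P → Dec (∃ P)

search-Vec : ∀ {A} → Searchable A → ∀ n → Searchable (Vec A n)
search-Vec search zero    P? = map′ ([] ,_) (λ { ([] , p) → p }) (P? [])
search-Vec search (suc n) P? =
  map′ (λ (x , xs , p) → x ∷ xs , p) (λ { (x ∷ xs , p) → x , xs , p })
    (search λ x → search-Vec search n λ xs → P? (x ∷ xs))

least : ∀ {P : ℕ → Set} → Decidable P → ∀ n → P n → ∃ λ k → (P k × (∀ j → P j → k ≤ j)) × k ≤ n
least P? n pn with P? 0
least P? n       pn | yes p0 = 0 , (p0 , λ _ _ → z≤n) , z≤n
least P? zero    pn | no ¬p0 = contradiction pn ¬p0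
least P? (suc n) pn | no ¬p0 with k , (pk , k≤) , k≤n ← least (P? ∘ suc) n pn =
  suc k , (pk , λ { zero p0 → contradiction p0 ¬p0 ; (suc j) pj → s≤s (k≤ j pj) }) , s≤s k≤n

Adj? : Graph → Set
Adj? G = ∀ u v → Dec (Graph.Adj G u v)

-- A colouring and the one rebuilt from its table agree pointwise but are not equal as records, so
-- copies have to be transported.
recolour : ∀ {N k G} {c c′ : EdgeColouring N k} {i} →
  (∀ u v → EdgeColouring.colour c u v ≡ EdgeColouring.colour c′ u v) →
  MonochromaticCopy G c i → MonochromaticCopy G c′ i
recolour eq copy = record
  { embed      = embed
  ; injective  = injective
  ; monochrome = λ adj → trans (sym (eq _ _)) (monochrome adj)
  } where open MonochromaticCopy copy

copy? : ∀ {N k G} → Adj? G → (c : EdgeColouring N k) → ∀ i → Dec (MonochromaticCopy G c i)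
copy? {N} {G = G} adj? c i = map′
  (λ (w , inj , mono) → record
    { embed = lookup w ; injective = inj _ _ ; monochrome = mono _ _ })
  (λ copy → let open MonochromaticCopy copy
                look = lookup∘tabulate embed in
    tabulate embed ,
    (λ u v eq → injective (trans (sym (look u)) (trans eq (look v)))) ,
    (λ u v adj → trans (cong₂ colour (look u) (look v)) (monochrome adj)))
  (search-Vec any? order λ w →
    (all? λ u → all? λ v → (lookup w u ≟ᶠ lookup w v) →-dec (u ≟ᶠ v)) ×-dec
    (all? λ u → all? λ v → adj? u v →-dec (colour (lookup w u) (lookup w v) ≟ᶠ i)))
  where
  open Graph G
  open EdgeColouring c

anyCopy? : ∀ {N k} (Gs : Vec Graph k) → (∀ i → Adj? (lookup Gs i)) → (c : EdgeColouring N k) →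
  Dec (∃ λ i → MonochromaticCopy (lookup Gs i) c i)
anyCopy? Gs adj? c = any? λ i → copy? (adj? i) c i

-- Deciding the relation is what allows the Ramsey number to be found as a least element. A
-- counterexample is sought among all tables; if there is none, decidability of having a copy
-- removes the double negation.
arrows? : ∀ {k} (Gs : Vec Graph k) → (∀ i → Adj? (lookup Gs i)) → ∀ N → Dec (Arrows N Gs)
arrows? {k} Gs adj? N = map′ noCounterexample⇒arrows arrows⇒noCounterexample
  (¬? (search-Vec (search-Vec any? N) N counterexample?))
  where
  open EdgeColouring
  TableSymmetric : Vec (Vec (Fin k) N) N → Set
  TableSymmetric w = ∀ u v → lookup (lookup w u) v ≡ lookup (lookup w v) u

  fromTable : ∀ w → TableSymmetric w → EdgeColouring N k
  fromTable w s = record { colour = λ u v → lookup (lookup w u) v ; colour-sym = s }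

  Counterexample : Vec (Vec (Fin k) N) N → Set
  Counterexample w = ∃ λ s → ¬ ∃ λ i → MonochromaticCopy (lookup Gs i) (fromTable w s) i

  counterexample? : Decidable Counterexample
  counterexample? w with all? (λ u → all? λ v → lookup (lookup w u) v ≟ᶠ lookup (lookup w v) u)
  ... | no ¬s = no (¬s ∘ proj₁)
  ... | yes s = map′ (s ,_)
    -- The counterexample may carry another proof of symmetry; the colour values are the same.
    (λ (_ , ¬copy) (i , copy) → ¬copy (i , recolour (λ _ _ → refl) copy))
    (¬? (anyCopy? Gs adj? (fromTable w s)))

  table : EdgeColouring N k → Vec (Vec (Fin k) N) N
  table c = tabulate λ u → tabulate λ v → colour c u v

  table-lookup : ∀ c u v → lookup (lookup (table c) u) v ≡ colour c u v
  table-lookup c u v = trans (cong (λ row → lookup row v) (lookup∘tabulate _ u)) (lookup∘tabulate _ v)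

  symmetric : ∀ c → TableSymmetric (table c)
  symmetric c u v = trans (table-lookup c u v) (trans (colour-sym c u v) (sym (table-lookup c v u)))

  noCounterexample⇒arrows : ¬ ∃ Counterexample → Arrows N Gs
  noCounterexample⇒arrows none c = decidable-stable (anyCopy? Gs adj? c) λ ¬copy →
    none (table c , symmetric c , λ (i , copy) → ¬copy (i , recolour (table-lookup c) copy))

  arrows⇒noCounterexample : Arrows N Gs → ¬ ∃ Counterexample
  arrows⇒noCounterexample arr (w , s , ¬copy) = ¬copy (arr (fromTable w s))

C-adj? : ∀ n → Adj? (C n)
C-adj? n u v = ¬? (u ≟ᶠ v) ×-dec (cyclicSuc? u v ⊎-dec cyclicSuc? v u)
  where
  cyclicSuc? : ∀ (u v : Fin n) → Dec (CyclicSuc u v)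
  cyclicSuc? u v = (suc (toℕ u) ≟ toℕ v) ⊎-dec ((suc (toℕ u) ≟ n) ×-dec (toℕ v ≟ 0))

K-adj? : ∀ a b → Adj? (K a b)
K-adj? a b u v = ((toℕ u <? a) ×-dec (a ≤? toℕ v)) ⊎-dec ((toℕ v <? a) ×-dec (a ≤? toℕ u))

cycles-K-adj? : ∀ {t} (n : Vec ℕ t) a b i → Adj? (lookup (map C n ∷ʳ K a b) i)
cycles-K-adj? []      a b zero    = K-adj? a b
cycles-K-adj? (n ∷ _) a b zero    = C-adj? n
cycles-K-adj? (_ ∷ n) a b (suc i) = cycles-K-adj? n a b i

-- Two colours on three parts

n≤2^n : ∀ n → n ≤ 2 ^ n
n≤2^n zero    = z≤n
n≤2^n (suc n) = begin
  1 + n           ≤⟨ +-mono-≤ (m^n>0 2 n) (n≤2^n n) ⟩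
  2 ^ n + 2 ^ n   ≡⟨ cong (2 ^ n +_) (+-identityʳ (2 ^ n)) ⟨
  2 ^ suc n       ∎

-- Take the least `d` with `m ≤ 2 ^ d`. By minimality all earlier levels have size at most `m`,
-- where the expander applies, and the last at most `2 * m`.
treeDepth : ∀ m → 1 ≤ m → ∃ λ d → m ≤ 2 ^ d × (∀ {j} → j < d → 2 ^ j ≤ m) × 2 ^ d ≤ 2 * m
treeDepth m 1≤m with d , (m≤2^d , minimal) , _ ← least (λ d → m ≤? 2 ^ d) m (n≤2^n m) =
  d , m≤2^d , below , upper d below
  where
  below : ∀ {j} → j < d → 2 ^ j ≤ m
  below {j} j<d = ≰⇒≥ λ m≤2^j → <⇒≱ j<d (minimal j m≤2^j)

  upper : ∀ d → (∀ {j} → j < d → 2 ^ j ≤ m) → 2 ^ d ≤ 2 * m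
  upper zero    _     = ≤-trans 1≤m (m≤m+n m _)
  upper (suc d) below = *-monoʳ-≤ 2 (below ≤-refl)

even-or-odd : ∀ n → ∃ λ i → n ≡ i + i ⊎ n ≡ suc (i + i)
even-or-odd zero = 0 , inj₁ refl
even-or-odd (suc n) with even-or-odd n
... | i , inj₁ refl = i , inj₂ refl
... | i , inj₂ refl = suc i , inj₁ (cong suc (sym (+-suc i i)))

module _ {N k : ℕ} (c : EdgeColouring N k) where
  open EdgeColouring c

  Coloured : Fin k → Fin N → Fin N → Set
  Coloured i x y = colour x y ≡ i

  Coloured-sym : ∀ {i x y} → Coloured i x y → Coloured i y x
  Coloured-sym {x = x} {y} eq = trans (colour-sym y x) eq

  -- Steps of the path give all cyclically consecutive pairs except the wrap-around, which is the
  -- closing edge.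
  closedPath⇒copy : ∀ {i S l u v} → Paths.Path (Coloured i) S l u v → Coloured i v u →
    MonochromaticCopy (C l) c i
  closedPath⇒copy {i} {l = l} p closing = record
    { embed      = at p
    ; injective  = at-injective p
    ; monochrome = λ { (_ , inj₁ s) → along s ; (_ , inj₂ s) → Coloured-sym (along s) }
    }
    where
    open Paths (Coloured i)
    along : ∀ {x y} → CyclicSuc x y → Coloured i (at p x) (at p y)
    along {x} {y} (inj₁ eq)          = at-step p x y eq
    along {x} {y} (inj₂ (last , first)) rewrite at-last p x last | at-first p y first = closing

  complete⇒copy : ∀ {i a b} {X Y : Subset N} → Disjoint X Y → a ≤ ∣ X ∣ → b ≤ ∣ Y ∣ →
    (∀ {x y} → x ∈ X → y ∈ Y → Coloured i x y) → MonochromaticCopy (K a b) c i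
  complete⇒copy {i} {a} {b} {X} {Y} X#Y a≤X b≤Y mono
    with eX , injX , eX∈ ← enumerate X a≤X | eY , injY , eY∈ ← enumerate Y b≤Y = record
    { embed      = [ eX , eY ]′ ∘ splitAt a
    ; injective  = λ {u} {v} → inj u v
    ; monochrome = λ { (inj₁ (u< , ≤v)) → across u< ≤v ; (inj₂ (v< , ≤u)) → Coloured-sym (across v< ≤u) }
    }
    where
    inj : ∀ u v → [ eX , eY ]′ (splitAt a u) ≡ [ eX , eY ]′ (splitAt a v) → u ≡ v
    inj u v eq with splitAt a u in u≡ | splitAt a v in v≡
    ... | inj₁ u′ | inj₁ v′ with refl ← injX eq = trans (sym (splitAt⁻¹-↑ˡ u≡)) (splitAt⁻¹-↑ˡ v≡)
    ... | inj₁ u′ | inj₂ v′ = contradiction (subst (_∈ Y) (sym eq) (eY∈ v′)) (X#Y (eX∈ u′))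
    ... | inj₂ u′ | inj₁ v′ = contradiction (subst (_∈ Y) eq (eY∈ u′)) (X#Y (eX∈ v′))
    ... | inj₂ u′ | inj₂ v′ with refl ← injY eq = trans (sym (splitAt⁻¹-↑ʳ u≡)) (splitAt⁻¹-↑ʳ v≡)

    across : ∀ {u v} → toℕ u < a → a ≤ toℕ v →
      Coloured i ([ eX , eY ]′ (splitAt a u)) ([ eX , eY ]′ (splitAt a v))
    across {u} {v} u<a a≤v rewrite splitAt-< a u u<a | splitAt-≥ a v a≤v = mono (eX∈ _) (eY∈ _)

  Bichromatic : Fin k → Fin k → Subset N → Subset N → Set
  Bichromatic r b X Y = ∀ {x y} → x ∈ X → y ∈ Y → Coloured r x y ⊎ Coloured b x y

  module _ {r b : Fin k} {a₁ a₂ : ℕ} (noK : ¬ MonochromaticCopy (K a₁ a₂) c b) where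

    RedEdge : Subset N → Subset N → Set
    RedEdge X Y = ∃₂ λ x y → x ∈ X × y ∈ Y × Coloured r x y

    redEdge : ∀ {X Y} → Disjoint X Y → Bichromatic r b X Y → a₁ ≤ ∣ X ∣ → a₂ ≤ ∣ Y ∣ → RedEdge X Y
    redEdge {X} {Y} X#Y bi a₁≤X a₂≤Y
      with any? (λ x → any? λ y → x ∈? X ×-dec y ∈? Y ×-dec (colour x y ≟ᶠ r))
    ... | yes (x , y , x∈ , y∈ , red) = x , y , x∈ , y∈ , red
    ... | no none = contradiction (complete⇒copy X#Y a₁≤X a₂≤Y λ {x} {y} x∈ y∈ →
            case bi x∈ y∈ of λ
              { (inj₁ red)  → contradiction (x , y , x∈ , y∈ , red) none
              ; (inj₂ blue) → blue }) noK

    redEdge′ : ∀ {X Y} → Disjoint X Y → Bichromatic r b X Y → a₂ ≤ ∣ X ∣ → a₁ ≤ ∣ Y ∣ → RedEdge X Y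
    redEdge′ X#Y bi a₂≤X a₁≤Y
      with y , x , y∈ , x∈ , red ← redEdge (λ y∈ x∈ → X#Y x∈ y∈)
             (λ y∈ x∈ → case bi x∈ y∈ of λ
               { (inj₁ red) → inj₁ (Coloured-sym red) ; (inj₂ blue) → inj₂ (Coloured-sym blue) }) a₁≤Y a₂≤X
      = x , y , x∈ , y∈ , Coloured-sym red

    -- Whichever of `a₁` and `a₂` is smaller determines which of `X` and `Y` would be the first part
    -- of a blue copy.
    redEdge-⊓⊔ : ∀ {X Y} → Disjoint X Y → Bichromatic r b X Y → a₁ ⊓ a₂ ≤ ∣ X ∣ → a₁ ⊔ a₂ ≤ ∣ Y ∣ → RedEdge X Y
    redEdge-⊓⊔ X#Y bi min≤X max≤Y with ≤-total a₁ a₂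
    ... | inj₁ a₁≤a₂ = redEdge X#Y bi (subst (_≤ _) (m≤n⇒m⊓n≡m a₁≤a₂) min≤X) (m⊔n≤o⇒n≤o a₁ a₂ max≤Y)
    ... | inj₂ a₂≤a₁ = redEdge′ X#Y bi (subst (_≤ _) (m≥n⇒m⊓n≡n a₂≤a₁) min≤X) (m⊔n≤o⇒m≤o a₁ a₂ max≤Y)

    redTo? : ∀ S z → Dec (∃ λ x → x ∈ S × Coloured r x z)
    redTo? S z = any? λ x → x ∈? S ×-dec (colour x z ≟ᶠ r)

    lone : Subset N → Subset N → Subset N
    lone Z S = Z ─ ⟦ redTo? S ⟧

    lone-noRed : ∀ {S} Z → Disjoint S Z → Bichromatic r b S Z → ¬ RedEdge S (lone Z S)
    lone-noRed {S} Z S#Z bi (x , z , x∈ , z∈ , red) = x∈p─q⇒x∉q Z ⟦ redTo? S ⟧ z∈ (∈⟦⟧⁺ (redTo? S) (x , x∈ , red))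

    -- Fewer than a₁ vertices of Z have no red neighbour in X, and fewer than a₂ none in Y.
    commonNeighbour : ∀ {X Y Z} → Disjoint X Z → Disjoint Y Z → Bichromatic r b X Z → Bichromatic r b Y Z →
      a₂ ≤ ∣ X ∣ → a₁ ≤ ∣ Y ∣ → a₁ + a₂ ≤ suc ∣ Z ∣ →
      ∃ λ z → z ∈ Z × (∃ λ x → x ∈ X × Coloured r x z) × (∃ λ y → y ∈ Y × Coloured r y z)
    commonNeighbour {X} {Y} {Z} X#Z Y#Z biX biY a₂≤X a₁≤Y Z-size
      with any? (λ z → z ∈? Z ×-dec redTo? X z ×-dec redTo? Y z)
    ... | yes found = found
    ... | no none = contradiction Z-size (<⇒≱ (begin-strict
      suc ∣ Z ∣                            ≤⟨ s≤s (⊆∪⇒∣∣≤ (lone Z X) (lone Z Y) Z⊆) ⟩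
      suc (∣ lone Z X ∣ + ∣ lone Z Y ∣)    ≤⟨ +-monoˡ-≤ _ loneX<a₁ ⟩
      a₁ + ∣ lone Z Y ∣                    <⟨ +-monoʳ-< a₁ loneY<a₂ ⟩
      a₁ + a₂                              ∎))
      where
      loneX<a₁ : ∣ lone Z X ∣ < a₁
      loneX<a₁ = ≰⇒> λ a₁≤ → lone-noRed Z X#Z biX
        (redEdge′ (λ x∈ z∈ → X#Z x∈ (p─q⊆p Z _ z∈)) (λ x∈ z∈ → biX x∈ (p─q⊆p Z _ z∈)) a₂≤X a₁≤)

      loneY<a₂ : ∣ lone Z Y ∣ < a₂
      loneY<a₂ = ≰⇒> λ a₂≤ → lone-noRed Z Y#Z biY
        (redEdge (λ x∈ z∈ → Y#Z x∈ (p─q⊆p Z _ z∈)) (λ x∈ z∈ → biY x∈ (p─q⊆p Z _ z∈)) a₁≤Y a₂≤)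

      Z⊆ : Z ⊆ lone Z X ∪ lone Z Y
      Z⊆ {z} z∈Z = x∈p∪q⁺ (case redTo? X z of λ
        { (no ¬X)  → inj₁ (x∈p∧x∉q⇒x∈p─q z∈Z (¬X ∘ ∈⟦⟧⁻ (redTo? X)))
        ; (yes toX) → inj₂ (x∈p∧x∉q⇒x∈p─q z∈Z λ z∈ → none (z , z∈Z , toX , ∈⟦⟧⁻ (redTo? Y) z∈)) })

-- A connector needs `30m + 5M + ℓ` vertices on each side. After cancellation the claim is
-- `14m₁ ≤ 18m₂` if `m₁ ≤ m₂`, and `7m₂ ≤ 11m₁` otherwise.
partSize≤ : ∀ {m₁ m₂ ℓ} → ℓ ≤ m₂ → let m = m₁ ⊓ m₂; M = m₁ ⊔ m₂; s = M + 12 * m in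
  (M + M) + (s + (s + ((M + (ℓ + 2 * m)) + 2 * m + 2 * m))) ≤ 16 * m₁ + 24 * m₂
partSize≤ {m₁} {m₂} {ℓ} ℓ≤m₂ = begin
  (M + M) + (s + (s + ((M + (ℓ + 2 * m)) + 2 * m + 2 * m)))
    ≡⟨ solve 3 (λ m M ℓ → (M :+ M) :+ ((M :+ con 12 :* m) :+ ((M :+ con 12 :* m) :+
         ((M :+ (ℓ :+ con 2 :* m)) :+ con 2 :* m :+ con 2 :* m))) := con 30 :* m :+ con 5 :* M :+ ℓ) refl m M ℓ ⟩
  30 * m + 5 * M + ℓ                ≤⟨ +-monoʳ-≤ (30 * m + 5 * M) ℓ≤m₂ ⟩
  30 * m + 5 * M + m₂               ≤⟨ bound ⟩
  16 * m₁ + 24 * m₂                 ∎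
  where
  m M s : ℕ
  m = m₁ ⊓ m₂
  M = m₁ ⊔ m₂
  s = M + 12 * m

  bound : 30 * m + 5 * M + m₂ ≤ 16 * m₁ + 24 * m₂
  bound with ≤-total m₁ m₂
  ... | inj₁ m₁≤m₂ rewrite m≤n⇒m⊓n≡m m₁≤m₂ | m≤n⇒m⊔n≡n m₁≤m₂ = begin
    30 * m₁ + 5 * m₂ + m₂
      ≡⟨ solve 2 (λ x y → con 30 :* x :+ con 5 :* y :+ y := con 14 :* x :+ (con 16 :* x :+ con 6 :* y)) refl m₁ m₂ ⟩
    14 * m₁ + (16 * m₁ + 6 * m₂)
      ≤⟨ +-monoˡ-≤ _ (*-mono-≤ {14} {18} (m≤m+n 14 4) m₁≤m₂) ⟩
    18 * m₂ + (16 * m₁ + 6 * m₂)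
      ≡⟨ solve 2 (λ x y → con 18 :* y :+ (con 16 :* x :+ con 6 :* y) := con 16 :* x :+ con 24 :* y) refl m₁ m₂ ⟩
    16 * m₁ + 24 * m₂ ∎
  ... | inj₂ m₂≤m₁ rewrite m≥n⇒m⊓n≡n m₂≤m₁ | m≥n⇒m⊔n≡m m₂≤m₁ = begin
    30 * m₂ + 5 * m₁ + m₂
      ≡⟨ solve 2 (λ x y → con 30 :* y :+ con 5 :* x :+ y := con 7 :* y :+ (con 5 :* x :+ con 24 :* y)) refl m₁ m₂ ⟩
    7 * m₂ + (5 * m₁ + 24 * m₂)
      ≤⟨ +-monoˡ-≤ _ (*-mono-≤ {7} {11} (m≤m+n 7 4) m₂≤m₁) ⟩
    11 * m₁ + (5 * m₁ + 24 * m₂)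
      ≡⟨ solve 2 (λ x y → con 11 :* x :+ (con 5 :* x :+ con 24 :* y) := con 16 :* x :+ con 24 :* y) refl m₁ m₂ ⟩
    16 * m₁ + 24 * m₂ ∎

-- From `16 · 2 ^ d ≤ 32m ≤ Q` the logarithm of `Q` is at least `d + 4`, so `x ≥ 2d + 10`. The
-- number `2d + 6` is the order of the shortest connecting path.
2d+6≤x : ∀ {d m Q x} → 2 ^ d ≤ 2 * m → 32 * m ≤ Q → 2 * ⌈log₂ Q ⌉ + 2 ≤ x → d + d + 6 ≤ x
2d+6≤x {d} {m} {Q} {x} 2^d≤ 32m≤Q log≤x = begin
  d + d + 6              ≤⟨ +-monoʳ-≤ (d + d) (m≤m+n 6 4) ⟩
  d + d + 10             ≡⟨ solve 1 (λ d → d :+ d :+ con 10 := con 2 :* (con 4 :+ d) :+ con 2) refl d ⟩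
  2 * (4 + d) + 2        ≡⟨ cong (λ e → 2 * e + 2) (⌈log₂2^n⌉≡n (4 + d)) ⟨
  2 * ⌈log₂ 2 ^ (4 + d) ⌉ + 2 ≤⟨ +-monoˡ-≤ 2 (*-monoʳ-≤ 2 (⌈log₂⌉-mono-≤ 2^[4+d]≤Q)) ⟩
  2 * ⌈log₂ Q ⌉ + 2      ≤⟨ log≤x ⟩
  x                      ∎
  where
  2^[4+d]≤Q : 2 ^ (4 + d) ≤ Q
  2^[4+d]≤Q = begin
    2 ^ (4 + d)          ≡⟨ ^-distribˡ-+-* 2 4 d ⟩
    16 * 2 ^ d           ≤⟨ *-monoʳ-≤ 16 2^d≤ ⟩
    16 * (2 * m)         ≡⟨ *-assoc 16 2 m ⟨
    32 * m               ≤⟨ 32m≤Q ⟩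
    Q                    ∎

mapPath : ∀ {V : Set} {R R′ : V → V → Set} {S k u v} → (∀ {x y} → R x y → R′ x y) →
  Paths.Path R S k u v → Paths.Path R′ S k u v
mapPath R⇒R′ (Paths.end v∈)      = Paths.end v∈
mapPath R⇒R′ (Paths.step u∈ r p) = Paths.step u∈ (R⇒R′ r) (mapPath R⇒R′ p)

module Tripartite {N k : ℕ} (c : EdgeColouring N k) {r b : Fin k} {m₁ m₂ : ℕ} (1≤m₁ : 1 ≤ m₁) (1≤m₂ : 1 ≤ m₂)
  {A B Z : Subset N} (A#B : Disjoint A B) (A#Z : Disjoint A Z) (B#Z : Disjoint B Z)
  (AB : Bichromatic c r b A B) (AZ : Bichromatic c r b A Z) (BZ : Bichromatic c r b B Z)
  (A-size : 16 * m₁ + 24 * m₂ ≤ ∣ A ∣) (B-size : 16 * m₁ + 24 * m₂ ≤ ∣ B ∣) (Z-size : m₁ + m₂ ≤ suc ∣ Z ∣)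
  (noK : ¬ MonochromaticCopy (K m₁ m₂) c b) where

  open EdgeColouring c

  σ : Fin N → Bool
  σ x = does (x ∈? A)

  σ-true : ∀ {x} → σ x ≡ true → x ∈ A
  σ-true {x} eq with x ∈? A | eq
  ... | yes x∈A | _ = x∈A

  σ-false : ∀ {x} → x ∈ A ∪ B → σ x ≡ false → x ∈ B
  σ-false {x} x∈ eq with x ∈? A | eq | x∈p∪q⁻ A B x∈
  ... | no x∉A | _ | inj₁ x∈A = contradiction x∈A x∉A
  ... | no _   | _ | inj₂ x∈B = x∈B

  -- Red edges within `A`, or between vertices outside `A`, are dropped to make the graph bipartite.
  -- Vertices outside `A ∪ B` also get `false`, but all sets used later lie in `A ∪ B`.
  R : Fin N → Fin N → Set
  R x y = Coloured c r x y × σ x ≡ not (σ y)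

  joined : ∀ s {X Y : Subset N} → X ⊆ A ∪ B → Y ⊆ A ∪ B →
    (∀ {x} → x ∈ X → σ x ≡ s) → (∀ {y} → y ∈ Y → σ y ≡ not s) →
    m₁ ⊓ m₂ ≤ ∣ X ∣ → m₁ ⊔ m₂ ≤ ∣ Y ∣ → ∃₂ λ x y → x ∈ X × y ∈ Y × R x y
  joined s {X} {Y} X⊆ Y⊆ X-side Y-side min≤X max≤Y =
    let x , y , x∈ , y∈ , red = redEdge-⊓⊔ c noK {X} {Y} (disjoint s X-side Y-side) (bi s X-side Y-side) min≤X max≤Y
    in x , y , x∈ , y∈ , red , trans (X-side x∈) (not-swap (Y-side y∈))
    where
    disjoint : ∀ s → (∀ {x} → x ∈ X → σ x ≡ s) → (∀ {y} → y ∈ Y → σ y ≡ not s) → Disjoint X Y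
    disjoint true  X-side Y-side x∈X x∈Y = A#B (σ-true (X-side x∈X)) (σ-false (Y⊆ x∈Y) (Y-side x∈Y))
    disjoint false X-side Y-side x∈X x∈Y = A#B (σ-true (Y-side x∈Y)) (σ-false (X⊆ x∈X) (X-side x∈X))

    bi : ∀ s → (∀ {x} → x ∈ X → σ x ≡ s) → (∀ {y} → y ∈ Y → σ y ≡ not s) → Bichromatic c r b X Y
    bi true  X-side Y-side x∈ y∈ = AB (σ-true (X-side x∈)) (σ-false (Y⊆ y∈) (Y-side y∈))
    bi false X-side Y-side x∈ y∈ with AB (σ-true (Y-side y∈)) (σ-false (X⊆ x∈) (X-side x∈))
    ... | inj₁ red  = inj₁ (Coloured-sym c red)
    ... | inj₂ blue = inj₂ (Coloured-sym c blue)

  open Dense R (λ x y → (colour x y ≟ᶠ r) ×-dec (σ x ≟ᵇ not (σ y)))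
    (λ (red , opp) → Coloured-sym c red , not-swap opp) σ proj₂ (A ∪ B) (m₁ ⊓ m₂) (m₁ ⊔ m₂)
    (⊓-glb 1≤m₁ 1≤m₂) joined

  A∪B-balanced : ∀ {l} → l ≤ 16 * m₁ + 24 * m₂ → Balanced l (A ∪ B)
  A∪B-balanced l≤ true  = ≤-trans (≤-trans l≤ A-size) (p⊆q⇒∣p∣≤∣q∣ λ {x} x∈ →
    x∈p∩q⁺ (p⊆p∪q B x∈ , subst (λ s → x ∈ side s) (dec-true (x ∈? A) x∈) ∈side⁺))
  A∪B-balanced l≤ false = ≤-trans (≤-trans l≤ B-size) (p⊆q⇒∣p∣≤∣q∣ λ {x} x∈ →
    x∈p∩q⁺ (q⊆p∪q A B x∈ , subst (λ s → x ∈ side s) (dec-false (x ∈? A) (λ x∈A → A#B x∈A x∈)) ∈side⁺))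

  #Z : ∀ {X} → X ⊆ A ∪ B → Disjoint X Z
  #Z X⊆ x∈ z∈ = [ (λ x∈A → A#Z x∈A z∈) , (λ x∈B → B#Z x∈B z∈) ]′ (x∈p∪q⁻ A B (X⊆ x∈))

  bichromatic-Z : ∀ {X} → X ⊆ A ∪ B → Bichromatic c r b X Z
  bichromatic-Z X⊆ x∈ z∈ = [ (λ x∈A → AZ x∈A z∈) , (λ x∈B → BZ x∈B z∈) ]′ (x∈p∪q⁻ A B (X⊆ x∈))

  evenCycle : ∀ {l} → Connector l → MonochromaticCopy (C l) c r
  evenCycle conn =
    let open Connector conn
        x , y , x∈ , y∈ , red , _ = joined _ X⊆U Y⊆U X-side Y-side (≤-trans (m⊓n≤m⊔n m₁ m₂) M≤∣X∣) M≤∣Y∣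
    in closedPath⇒copy c (mapPath proj₁ (path x∈ y∈)) (Coloured-sym c red)

  oddCycle : ∀ {l} → Connector l → MonochromaticCopy (C (suc l)) c r
  oddCycle conn =
    let open Connector conn
        z , z∈ , (x , x∈ , xz) , (y , y∈ , yz) = commonNeighbour c noK {X} {Y} {Z} (#Z X⊆U) (#Z Y⊆U)
          (bichromatic-Z X⊆U) (bichromatic-Z Y⊆U) (m⊔n≤o⇒n≤o m₁ m₂ M≤∣X∣) (m⊔n≤o⇒m≤o m₁ m₂ M≤∣Y∣) Z-size
    in closedPath⇒copy c {S = λ v → v ∈ A ∪ B ⊎ v ≡ z}
         (Paths.step (inj₂ refl) (Coloured-sym c xz)
           (Paths.weaken _ (λ v∈ → inj₁ v∈ , λ { refl → #Z {A ∪ B} (λ v∈ → v∈) v∈ z∈ })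
             (mapPath proj₁ (path x∈ y∈)))) yz

  -- Write `x = 2d + 6 + y`. Halving `y` fixes the length of the middle path, and its parity decides
  -- between closing by a red edge and closing through `Z`.
  redCycle : ∀ {x Q} → x ≤ m₂ → 32 * m₁ ≤ Q → 2 * ⌈log₂ Q ⌉ + 2 ≤ x → MonochromaticCopy (C x) c r
  redCycle {x} {Q} x≤m₂ 32m₁≤Q log≤x =
    let m = m₁ ⊓ m₂
        d , m≤2^d , small , 2^d≤2m = treeDepth m (⊓-glb 1≤m₁ 1≤m₂)
        y , eq = m≤n⇒∃[o]m+o≡n (2d+6≤x {d} {m} 2^d≤2m (≤-trans (*-monoʳ-≤ 32 (m⊓n≤m m₁ m₂)) 32m₁≤Q) log≤x)
        i , y≡ = even-or-odd y
    in build d i m≤2^d small eq y≡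
    where
    build : ∀ d i {y} → m₁ ⊓ m₂ ≤ 2 ^ d → (∀ {j} → j < d → 2 ^ j ≤ m₁ ⊓ m₂) → d + d + 6 + y ≡ x →
      y ≡ i + i ⊎ y ≡ suc (i + i) → MonochromaticCopy (C x) c r
    build d i {y} m≤2^d small eq y≡ = close y≡
      where
      y≥2i : i + i ≤ y
      y≥2i = [ (λ { refl → ≤-refl }) , (λ { refl → n≤1+n _ }) ]′ y≡

      conn : Connector (1 + (suc d + (2 + (i + i) + (suc d + 1))))
      conn = connector d i m≤2^d small (A∪B-balanced (partSize≤ {m₁} {m₂} (begin
        2 + (i + i)     ≤⟨ +-mono-≤ (≤-trans (m≤m+n 2 4) (m≤n+m 6 (d + d))) y≥2i ⟩
        d + d + 6 + y   ≡⟨ eq ⟩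
        x               ≤⟨ x≤m₂ ⟩
        m₂              ∎)))

      count : 1 + (suc d + (2 + (i + i) + (suc d + 1))) ≡ d + d + 6 + (i + i)
      count = solve 2 (λ d i → con 1 :+ (con 1 :+ d :+ (con 2 :+ (i :+ i) :+ (con 1 :+ d :+ con 1)))
                := d :+ d :+ con 6 :+ (i :+ i)) refl d i

      close : y ≡ i + i ⊎ y ≡ suc (i + i) → MonochromaticCopy (C x) c r
      close (inj₁ refl) = subst (λ l → MonochromaticCopy (C l) c r) (trans count eq) (evenCycle conn)
      close (inj₂ refl) = subst (λ l → MonochromaticCopy (C l) c r)
        (trans (cong suc count) (trans (sym (+-suc (d + d + 6) (i + i))) eq)) (oddCycle conn)

-- Induction on the number of cycles

tripartite : ∀ {N k} (c : EdgeColouring N k) {r b} {m₁ m₂ x Q} → 1 ≤ m₁ → 1 ≤ m₂ →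
  ∀ {A B Z : Subset N} → Disjoint A B → Disjoint A Z → Disjoint B Z →
  Bichromatic c r b A B → Bichromatic c r b A Z → Bichromatic c r b B Z →
  16 * m₁ + 24 * m₂ ≤ ∣ A ∣ → 16 * m₁ + 24 * m₂ ≤ ∣ B ∣ → m₁ + m₂ ≤ suc ∣ Z ∣ →
  x ≤ m₂ → 32 * m₁ ≤ Q → 2 * ⌈log₂ Q ⌉ + 2 ≤ x →
  MonochromaticCopy (C x) c r ⊎ MonochromaticCopy (K m₁ m₂) c b
tripartite c {b = b} {m₁} {m₂} 1≤m₁ 1≤m₂ A#B A#Z B#Z AB AZ BZ A-size B-size Z-size x≤m₂ 32m₁≤Q log≤x
  with copy? (K-adj? m₁ m₂) c b
... | yes blue = inj₂ blue
... | no noK = inj₁ (Tripartite.redCycle c 1≤m₁ 1≤m₂ A#B A#Z B#Z AB AZ BZ A-size B-size Z-size noK x≤m₂ 32m₁≤Q log≤x)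

pullback : ∀ {N N′ k} → EdgeColouring N k → (Fin N′ → Fin N) → EdgeColouring N′ k
pullback c e = record { colour = λ u v → colour (e u) (e v) ; colour-sym = λ u v → colour-sym (e u) (e v) }
  where open EdgeColouring c

pushCopy : ∀ {N N′ k G} {c : EdgeColouring N k} {e : Fin N′ → Fin N} {i} → Injective _≡_ _≡_ e →
  MonochromaticCopy G (pullback c e) i → MonochromaticCopy G c i
pushCopy {e = e} e-inj copy = record
  { embed = e ∘ embed ; injective = injective ∘ e-inj ; monochrome = monochrome }
  where open MonochromaticCopy copy

-- The first cycle colour joins the last colour and the others move down by one, so the merged
-- colouring matches the list of graphs with its first cycle removed.
mergeColour : ∀ {k} → Fin (suc (suc k)) → Fin (suc k)
mergeColour {k} zero = fromℕ k
mergeColour (suc i)  = i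

merge : ∀ {N k} → EdgeColouring N (suc (suc k)) → EdgeColouring N (suc k)
merge c = record { colour = λ u v → mergeColour (colour u v) ; colour-sym = λ u v → cong mergeColour (colour-sym u v) }
  where open EdgeColouring c

mergeColour-last : ∀ {k} (j : Fin (suc (suc k))) → mergeColour j ≡ fromℕ k → j ≡ zero ⊎ j ≡ suc (fromℕ k)
mergeColour-last zero    _    = inj₁ refl
mergeColour-last (suc i) refl = inj₂ refl

mergeColour-≢last : ∀ {k i} (j : Fin (suc (suc k))) → i ≢ fromℕ k → mergeColour j ≡ i → j ≡ suc i
mergeColour-≢last zero    i≢ refl = contradiction refl i≢
mergeColour-≢last (suc i) i≢ refl = refl

unmergeCopy : ∀ {N k G} {c : EdgeColouring N (suc (suc k))} {i} → i ≢ fromℕ k →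
  MonochromaticCopy G (merge c) i → MonochromaticCopy G c (suc i)
unmergeCopy i≢ copy = record
  { embed = embed ; injective = injective ; monochrome = λ adj → mergeColour-≢last _ i≢ (monochrome adj) }
  where open MonochromaticCopy copy

module KCopy {N k a b} {c : EdgeColouring N k} {i} (copy : MonochromaticCopy (K a b) c i) where
  open EdgeColouring c
  open MonochromaticCopy copy

  left : Fin a → Fin N
  left u = embed (u ↑ˡ b)

  right : Fin b → Fin N
  right v = embed (a ↑ʳ v)

  left-injective : Injective _≡_ _≡_ left
  left-injective = ↑ˡ-injective b _ _ ∘ injective

  right-injective : Injective _≡_ _≡_ right
  right-injective = ↑ʳ-injective a _ _ ∘ injective

  left<a : ∀ u → toℕ (u ↑ˡ b) < a
  left<a u = subst (_< a) (sym (toℕ-↑ˡ u b)) (toℕ<n u)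

  a≤right : ∀ (v : Fin b) → a ≤ toℕ (a ↑ʳ v)
  a≤right v = subst (a ≤_) (sym (toℕ-↑ʳ a v)) (m≤m+n a (toℕ v))

  left≢right : ∀ {u v} → left u ≢ right v
  left≢right {u} {v} eq = <⇒≱ (left<a u) (subst (λ w → a ≤ toℕ w) (sym (injective eq)) (a≤right v))

  across : ∀ u v → colour (left u) (right v) ≡ i
  across u v = monochrome (inj₁ (left<a u , a≤right v))

-- The inner copy splits the left part of the outer one. Its two parts and the outer right part are
-- pairwise completely joined in the merged colour, that is, in the two original colours.
nestedK : ∀ {N k} (c : EdgeColouring N (suc (suc k))) {M₁ M₂ p q m₁ m₂ x Q} → 1 ≤ m₁ → 1 ≤ m₂ →
  (outer : MonochromaticCopy (K M₁ M₂) (merge c) (fromℕ k)) →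
  MonochromaticCopy (K p q) (pullback (merge c) (KCopy.left outer)) (fromℕ k) →
  16 * m₁ + 24 * m₂ ≤ M₂ → 16 * m₁ + 24 * m₂ ≤ p → m₁ + m₂ ≤ suc q →
  x ≤ m₂ → 32 * m₁ ≤ Q → 2 * ⌈log₂ Q ⌉ + 2 ≤ x →
  MonochromaticCopy (C x) c zero ⊎ MonochromaticCopy (K m₁ m₂) c (suc (fromℕ k))
nestedK {N} {k} c {M₁} {M₂} {p} {q} 1≤m₁ 1≤m₂ outer inner M₂-size p-size q-size =
  tripartite c 1≤m₁ 1≤m₂ {image α} {image β} {image ζ}
    (disjoint α β (λ _ _ → O.left≢right)) (disjoint α ζ (λ _ _ → I.left≢right ∘ O.left-injective))
    (disjoint β ζ (λ _ _ → O.left≢right ∘ sym))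
    (bichromatic α β (λ u v → O.across (I.left u) v)) (bichromatic α ζ I.across)
    (bichromatic β ζ (λ u v → trans (cong mergeColour (colour-sym (β u) (ζ v))) (O.across (I.right v) u)))
    (≤-trans p-size (injective⇒≤∣image∣ α (I.left-injective ∘ O.left-injective)))
    (≤-trans M₂-size (injective⇒≤∣image∣ β O.right-injective))
    (≤-trans q-size (s≤s (injective⇒≤∣image∣ ζ (I.right-injective ∘ O.left-injective))))
  where
  open EdgeColouring c
  module O = KCopy outer
  module I = KCopy inner

  α : Fin p → Fin N
  α = O.left ∘ I.left
  β : Fin M₂ → Fin N
  β = O.right
  ζ : Fin q → Fin N
  ζ = O.left ∘ I.right

  disjoint : ∀ {a b} (g : Fin a → Fin N) (h : Fin b → Fin N) → (∀ u v → g u ≢ h v) → Disjoint (image g) (image h)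
  disjoint g h g≢h x∈g x∈h =
    let u , gu≡ = ∈image⁻ g x∈g ; v , hv≡ = ∈image⁻ h x∈h in g≢h u v (trans gu≡ (sym hv≡))

  bichromatic : ∀ {a b} (g : Fin a → Fin N) (h : Fin b → Fin N) →
    (∀ u v → mergeColour (colour (g u) (h v)) ≡ fromℕ k) →
    Bichromatic c zero (suc (fromℕ k)) (image g) (image h)
  bichromatic g h gh x∈g y∈h with ∈image⁻ g x∈g | ∈image⁻ h y∈h
  ... | u , refl | v , refl = mergeColour-last _ (gh u v)

lookup-∷ʳ-last : ∀ {A : Set₁} {n} (xs : Vec A n) x → lookup (xs ∷ʳ x) (fromℕ n) ≡ x
lookup-∷ʳ-last []       x = refl
lookup-∷ʳ-last (_ ∷ xs) x = lookup-∷ʳ-last xs x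

-- This serves the inequality `32m₁ ≤ Q` behind the logarithmic bound as well as the monotonicity
-- `M₂ ≤ M₁ ≤ Q` in the induction.
f-lower : ∀ t m₁ m₂ → 32 * m₁ + 49 * m₂ ≤ f (suc t) m₁ m₂
f-lower zero    m₁ m₂ = +-monoˡ-≤ (49 * m₂) (*-monoˡ-≤ m₁ (n≤1+n 32))
f-lower (suc t) m₁ m₂ = begin
  M                         ≤⟨ m≤m+n M _ ⟩
  49 * M                    ≤⟨ m≤n+m (49 * M) (32 * L) ⟩
  32 * L + 49 * M           ≤⟨ f-lower t L M ⟩
  f (suc (suc t)) m₁ m₂     ∎
  where
  L M : ℕ
  M = 32 * m₁ + 49 * m₂
  L = f (suc t) M (m₁ + m₂ ∸ 1)

Suitable : ∀ {t} → ℕ → ℕ → Vec ℕ t → Set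
Suitable {t} m Q n = (i : Fin t) → lookup n i ≤ m × 2 * ⌈log₂ Q ⌉ + 2 ≤ lookup n i

arrows-f : ∀ t m₁ m₂ (n : Vec ℕ (suc t)) → 1 ≤ m₁ → 1 ≤ m₂ → Suitable m₂ (f (suc t) m₁ m₂) n →
  Arrows (f (suc t) m₁ m₂) (map C n ∷ʳ K m₁ m₂)
arrows-f zero m₁ m₂ (x ∷ []) 1≤m₁ 1≤m₂ suitable c =
  [ zero ,_ , suc zero ,_ ]′ (tripartite c 1≤m₁ 1≤m₂ {A} {B} {Z} A#B A#Z B#Z two two two
    (≤-reflexive (sym ∣A∣)) (≤-reflexive (sym ∣B∣)) Z-size
    (proj₁ (suitable zero)) (≤-trans (m≤m+n _ _) (f-lower 0 m₁ m₂)) (proj₂ (suitable zero)))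
  where
  N s : ℕ
  N = 33 * m₁ + 49 * m₂
  s = 16 * m₁ + 24 * m₂

  -- The coefficients 33 and 49 are `2 · 16 + 1` and `2 · 24 + 1`: two large parts and a remainder
  -- `Z`.
  N≡ : N ≡ m₁ + m₂ + (s + s)
  N≡ = solve 2 (λ a b → con 33 :* a :+ con 49 :* b :=
         a :+ b :+ ((con 16 :* a :+ con 24 :* b) :+ (con 16 :* a :+ con 24 :* b))) refl m₁ m₂

  shrunkA = shrink {k = s} (⊤ {N}) (begin
    s                   ≤⟨ m≤m+n s s ⟩
    s + s               ≤⟨ m≤n+m (s + s) (m₁ + m₂) ⟩
    m₁ + m₂ + (s + s)   ≡⟨ N≡ ⟨
    N                   ≡⟨ ∣⊤∣≡n N ⟨
    ∣ ⊤ {N} ∣           ∎)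
  A : Subset N
  A = proj₁ shrunkA
  ∣A∣ : ∣ A ∣ ≡ s
  ∣A∣ = proj₂ (proj₂ shrunkA)

  rest-size : m₁ + m₂ + s ≤ ∣ ⊤ ─ A ∣
  rest-size = +-cancelʳ-≤ s _ _ (begin
    m₁ + m₂ + s + s         ≡⟨ +-assoc (m₁ + m₂) s s ⟩
    m₁ + m₂ + (s + s)       ≡⟨ N≡ ⟨
    N                       ≡⟨ ∣⊤∣≡n N ⟨
    ∣ ⊤ {N} ∣               ≤⟨ ∣p∣≤∣p─q∣+∣q∣ ⊤ A ⟩
    ∣ ⊤ ─ A ∣ + ∣ A ∣       ≡⟨ cong (∣ ⊤ ─ A ∣ +_) ∣A∣ ⟩
    ∣ ⊤ ─ A ∣ + s           ∎)

  shrunkB = shrink {k = s} (⊤ ─ A) (≤-trans (m≤n+m s (m₁ + m₂)) rest-size)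
  B Z : Subset N
  B = proj₁ shrunkB
  Z = (⊤ ─ A) ─ B
  ∣B∣ : ∣ B ∣ ≡ s
  ∣B∣ = proj₂ (proj₂ shrunkB)

  Z-size : m₁ + m₂ ≤ suc ∣ Z ∣
  Z-size = m≤n⇒m≤1+n (+-cancelʳ-≤ s _ _ (begin
    m₁ + m₂ + s         ≤⟨ rest-size ⟩
    ∣ ⊤ ─ A ∣           ≤⟨ ∣p∣≤∣p─q∣+∣q∣ (⊤ ─ A) B ⟩
    ∣ Z ∣ + ∣ B ∣       ≡⟨ cong (∣ Z ∣ +_) ∣B∣ ⟩
    ∣ Z ∣ + s           ∎))

  A#B : Disjoint A B
  A#B x∈A x∈B = x∈p─q⇒x∉q ⊤ A (proj₁ (proj₂ shrunkB) x∈B) x∈A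
  A#Z : Disjoint A Z
  A#Z x∈A x∈Z = x∈p─q⇒x∉q ⊤ A (p─q⊆p (⊤ ─ A) B x∈Z) x∈A
  B#Z : Disjoint B Z
  B#Z x∈B x∈Z = x∈p─q⇒x∉q (⊤ ─ A) B x∈Z x∈B

  two : ∀ {X Y} → Bichromatic c zero (suc zero) X Y
  two {x = u} {v} _ _ with EdgeColouring.colour c u v
  ... | zero     = inj₁ refl
  ... | suc zero = inj₂ refl
arrows-f (suc t) m₁ m₂ (x ∷ n) 1≤m₁ 1≤m₂ suitable c = merged (arrows-f t M₁ M₂ n 1≤M₁ 1≤M₂ suitable₁ (merge c))
  where
  M₂ q M₁ Q : ℕ
  M₂ = 32 * m₁ + 49 * m₂
  q  = m₁ + m₂ ∸ 1
  M₁ = f (suc t) M₂ q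
  Q  = f (suc t) M₁ M₂

  Goal = ∃ λ i → MonochromaticCopy (lookup (map C (x ∷ n) ∷ʳ K m₁ m₂) i) c i

  m₂≤M₂ : m₂ ≤ M₂
  m₂≤M₂ = ≤-trans (m≤m+n m₂ _) (m≤n+m (49 * m₂) (32 * m₁))
  1≤M₂ : 1 ≤ M₂
  1≤M₂ = ≤-trans 1≤m₂ m₂≤M₂
  M₂≤M₁ : M₂ ≤ M₁
  M₂≤M₁ = ≤-trans (≤-trans (m≤m+n M₂ _) (m≤m+n (32 * M₂) _)) (f-lower t M₂ q)
  1≤M₁ : 1 ≤ M₁
  1≤M₁ = ≤-trans 1≤M₂ M₂≤M₁
  M₁≤Q : M₁ ≤ Q
  M₁≤Q = ≤-trans (≤-trans (m≤m+n M₁ _) (m≤m+n (32 * M₁) _)) (f-lower t M₁ M₂)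
  m₂≤q : m₂ ≤ q
  m₂≤q = ∸-monoˡ-≤ 1 (+-monoˡ-≤ m₂ 1≤m₁)

  suitable₁ : Suitable M₂ Q n
  suitable₁ i = let n≤ , log≤ = suitable (suc i) in ≤-trans n≤ m₂≤M₂ , log≤

  -- The cycle lengths still fit because `m₁ ≥ 1` gives `m₂ ≤ q`, and the logarithmic condition
  -- weakens because `M₁ ≤ Q`.
  suitable₂ : Suitable q M₁ n
  suitable₂ i = let n≤ , log≤ = suitable (suc i) in
    ≤-trans n≤ m₂≤q , ≤-trans (+-monoˡ-≤ 2 (*-monoʳ-≤ 2 (⌈log₂⌉-mono-≤ M₁≤Q))) log≤

  parts≤M₂ : 16 * m₁ + 24 * m₂ ≤ M₂
  parts≤M₂ = +-mono-≤ (*-monoˡ-≤ m₁ (m≤m+n 16 16)) (*-monoˡ-≤ m₂ (m≤m+n 24 25))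

  atLast : ∀ a b {N} {c′ : EdgeColouring N (suc (suc t))} →
    MonochromaticCopy (lookup (map C n ∷ʳ K a b) (fromℕ (suc t))) c′ (fromℕ (suc t)) →
    MonochromaticCopy (K a b) c′ (fromℕ (suc t))
  atLast a b {c′ = c′} = subst (λ G → MonochromaticCopy G c′ (fromℕ (suc t))) (lookup-∷ʳ-last (map C n) (K a b))

  -- Away from the last colour the target is a cycle whatever the bipartite graph, so cycles found
  -- with either pair of part sizes count.
  atCycle : ∀ {t} (n : Vec ℕ t) a b {i} → i ≢ fromℕ t → lookup (map C n ∷ʳ K a b) i ≡ lookup (map C n ∷ʳ K m₁ m₂) i
  atCycle []      a b {zero}  i≢ = contradiction refl i≢
  atCycle (_ ∷ n) a b {zero}  i≢ = refl
  atCycle (_ ∷ n) a b {suc i} i≢ = atCycle n a b (i≢ ∘ cong suc)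

  cycleFound : ∀ a b {i} → i ≢ fromℕ (suc t) → MonochromaticCopy (lookup (map C n ∷ʳ K a b) i) (merge c) i → Goal
  cycleFound a b {i} i≢ copy =
    suc i , unmergeCopy i≢ (subst (λ G → MonochromaticCopy G (merge c) i) (atCycle n a b i≢) copy)

  nested : (outer : MonochromaticCopy (K M₁ M₂) (merge c) (fromℕ (suc t))) →
    (∃ λ i → MonochromaticCopy (lookup (map C n ∷ʳ K M₂ q) i) (pullback (merge c) (KCopy.left outer)) i) → Goal
  nested outer (i , copy) with i ≟ᶠ fromℕ (suc t)
  ... | no i≢ = cycleFound M₂ q i≢ (pushCopy (KCopy.left-injective outer) copy)
  ... | yes refl = case nestedK c 1≤m₁ 1≤m₂ outer (atLast M₂ q copy) parts≤M₂ parts≤M₂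
          (m≤n+m∸n (m₁ + m₂) 1) (proj₁ (suitable zero))
          (≤-trans (m≤m+n (32 * m₁) _) (f-lower (suc t) m₁ m₂)) (proj₂ (suitable zero)) of λ
      { (inj₁ cycle) → zero , cycle
      ; (inj₂ blue)  → suc (fromℕ (suc t)) ,
          subst (λ G → MonochromaticCopy G c (suc (fromℕ (suc t)))) (sym (lookup-∷ʳ-last (map C n) (K m₁ m₂))) blue }

  merged : (∃ λ i → MonochromaticCopy (lookup (map C n ∷ʳ K M₁ M₂) i) (merge c) i) → Goal
  merged (i , copy) with i ≟ᶠ fromℕ (suc t)
  ... | no i≢ = cycleFound M₁ M₂ i≢ copy
  ... | yes refl = let outer = atLast M₁ M₂ copy in
    -- The left part of the outer copy has exactly `M₁ = f (suc t) M₂ q` vertices, as the second use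
    -- of the induction hypothesis requires.
    nested outer (arrows-f t M₂ q n 1≤M₂ (≤-trans 1≤m₂ m₂≤q) suitable₂ (pullback (merge c) (KCopy.left outer)))

theorem2p9 : (t : ℕ) .{{_ : NonZero t}} (m₁ m₂ : ℕ) (n : Vec ℕ t) →
    1 ≤ m₁ → 1 ≤ m₂ → ((i : Fin t) → 1 ≤ lookup n i) →
    ((i : Fin t) → lookup n i ≤ m₂ × 2 * ⌈log₂ f t m₁ m₂ ⌉ + 2 ≤ lookup n i) →
    ∃ λ R → IsRamseyNumber (map C n ∷ʳ K m₁ m₂) R × R ≤ f t m₁ m₂
theorem2p9 (suc t) m₁ m₂ n 1≤m₁ 1≤m₂ _ suitable =
  -- The search below a number that arrows yields the existence of the Ramsey number and its bound
  -- together.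
  least (arrows? (map C n ∷ʳ K m₁ m₂) (cycles-K-adj? n m₁ m₂)) (f (suc t) m₁ m₂)
    (arrows-f t m₁ m₂ n 1≤m₁ 1≤m₂ suitable)
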